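{- Let $q=p^n$, $p>2$ prime, $g\ge1$ with $\gcd(p,g)=1$, and let $C: y^2=x^{2g+1}+ax^{g+1}+bx$ be a genus $g$ hyperelliptic curve over $\mathbb{F}_q$ ($b\ne0$). Let $m=\frac{p-1}{2}$, let $W=(w_{i,j}(a,b))_{1\le i,j\le g}$ be the Cartier–Manin matrix of $C$, and fix $\sqrt b\in\mathbb{F}_{q^2}$. Then for $1\le i,j\le g$: 1. if $ip-j\equiv m\pmod g$, then $$w_{i,j}(a,b)=\sqrt{b}^{\,2m+\frac{m-(ip-j)}{g}}\; w_{i,j}\!\left(\tfrac{a}{\sqrt b},1\right)=\sqrt{b}^{\,2m+\frac{m-(ip-j)}{g}}\;P_{\frac{ip-j}{g}-\frac{p-1}{2g}}\!\left(-\frac{a}{2\sqrt b}\right),$$ where $w_{i,j}(\frac{a}{\sqrt b},1)$ denotes the corresponding entry of the Cartier–Manin matrix of $y^2=x^{2g+1}+\frac{a}{\sqrt b}x^{g+1}+x$, and the equality holds in $\mathbb{F}_{q^2}$ (and the value lies in $\mathbb{F}_q$); 2. otherwise $w_{i,j}(a,b)=0$.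
   Context: For a hyperelliptic curve $y^2=f(x)$ with $f$ monic of degree $2g+1$ over a field of characteristic $p>2$, write $f(x)^{(p-1)/2}=\sum_k c_k x^k$; the Cartier–Manin matrix is $W=(w_{i,j})_{1\le i,j\le g}$ with $w_{i,j}=c_{ip-j}$. $P_n$ denotes the $n$-th Legendre polynomial (its coefficients have only powers of 2 in denominators, so it is reduced modulo $p$). The notation $\sqrt b^{\,e}$ means the $e$-th power of the fixed element $\sqrt b$ (here $e$ is an integer). -}

module Defs where

open import Level as L using (Level; _⊔_)
open import Algebra.Bundles using (CommutativeRing; Semiring)
open import Algebra.Apartness.Bundles using (HeytingField; HeytingCommutativeRing)
import Algebra.Definitions.RawSemiring as RawSemiringDefs
open import Data.Fin.Base using (Fin; toℕ)
open import Data.Fin.Properties using (any?; inj⇒≟)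
open import Data.Integer.Base as ℤ using (ℤ; +_; -[1+_])
open import Data.List.Base using (List; []; _∷_; _++_; map; replicate)
open import Data.Nat.Base as ℕ using (ℕ; zero; suc)
open import Data.Nat.DivMod using (_/_)
open import Data.Product.Base using (_,_)
open import Data.Rational.Base as ℚ using (ℚ; 0ℚ; 1ℚ; -½; ↥_; ↧ₙ_)
open import Data.Rational.Properties using () renaming (+-*-commutativeRing to ℚ-commutativeRing)
open import Function.Bundles using (Inverse)
open import Function.Properties.Inverse using (Inverse⇒Injection)
open import Relation.Binary.Definitions using (Decidable)
open import Relation.Binary.PropositionalEquality as ≡ using (_≡_; refl)
open import Relation.Nullary.Decidable using (yes; no)

private
  variable
    c ℓ ℓ₁ ℓ₂ : Level

-- Univariate polynomials as coefficient lists, constant term first.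
-- Trailing zeros are allowed, so equality is _≈ₚ_, not _≡_.

module Polynomial (R : CommutativeRing c ℓ) where
  open CommutativeRing R

  infix  4 _≈ₚ_
  infixl 6 _+ₚ_
  infixr 7 _·ₚ_
  infixl 7 _*ₚ_
  infixr 8 _^ₚ_

  Poly : Set c
  Poly = List Carrier

  coeff : Poly → ℕ → Carrier
  coeff []      _       = 0#
  coeff (x ∷ f) zero    = x
  coeff (x ∷ f) (suc k) = coeff f k

  coeffℤ : Poly → ℤ → Carrier
  coeffℤ f (+ k)    = coeff f k
  coeffℤ f -[1+ _ ] = 0#

  _≈ₚ_ : Poly → Poly → Set ℓ
  f ≈ₚ h = ∀ k → coeff f k ≈ coeff h k

  _+ₚ_ : Poly → Poly → Poly
  []      +ₚ h       = h
  (x ∷ f) +ₚ []      = x ∷ f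
  (x ∷ f) +ₚ (y ∷ h) = x + y ∷ f +ₚ h

  _·ₚ_ : Carrier → Poly → Poly
  x ·ₚ f = map (x *_) f

  _*ₚ_ : Poly → Poly → Poly
  []      *ₚ h = []
  (x ∷ f) *ₚ h = x ·ₚ h +ₚ (0# ∷ f *ₚ h)

  _^ₚ_ : Poly → ℕ → Poly
  f ^ₚ zero  = 1# ∷ []
  f ^ₚ suc n = f *ₚ f ^ₚ n

  X^_ : ℕ → Poly
  X^ k = replicate k 0# ++ 1# ∷ []

  eval : Poly → Carrier → Carrier
  eval []      t = 0#
  eval (x ∷ f) t = x + t * eval f t

  Squarefree : Poly → Set (c ⊔ ℓ)
  Squarefree f = ∀ d e → d *ₚ d *ₚ e ≈ₚ f → ∀ k → coeff d (suc k) ≈ 0#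

  -- y² = f(x) is a hyperelliptic curve of genus g with f monic of degree 2g+1
  -- (in odd characteristic; genus 1 is allowed).
  record IsHyperelliptic (g : ℕ) (f : Poly) : Set (c ⊔ ℓ) where
    field
      degree≤    : ∀ k → 2 ℕ.* g ℕ.+ 1 ℕ.< k → coeff f k ≈ 0#
      monic      : coeff f (2 ℕ.* g ℕ.+ 1) ≈ 1#
      squarefree : Squarefree f

  curve : ℕ → Carrier → Carrier → Poly
  curve g a b = X^ (2 ℕ.* g ℕ.+ 1) +ₚ a ·ₚ X^ (g ℕ.+ 1) +ₚ b ·ₚ X^ 1

half : ℕ → ℕ
half p = (p ℕ.∸ 1) / 2

-- The exponent ip − j, where the Fin-indices 0, …, g−1 stand for 1, …, g.
-- It can be negative (when g > p), so it is formed in ℤ.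
cmIndex : (p : ℕ) {g : ℕ} → Fin g → Fin g → ℤ
cmIndex p i j = + (suc (toℕ i) ℕ.* p) ℤ.- + suc (toℕ j)

module _ (R : CommutativeRing c ℓ) where
  open CommutativeRing R using (Carrier)
  open Polynomial R

  cartierManin : (p g : ℕ) → Poly → Fin g → Fin g → Carrier
  cartierManin p g f i j = coeffℤ (f ^ₚ half p) (cmIndex p i j)

-- Legendre polynomials, by Bonnet's recurrence
--   (n+2) P₍ₙ₊₂₎ = (2n+3) x P₍ₙ₊₁₎ − (n+1) Pₙ

module ℚ[x] = Polynomial ℚ-commutativeRing

legendre : ℕ → ℚ[x].Poly
legendre zero          = 1ℚ ∷ []
legendre (suc zero)    = 0ℚ ∷ 1ℚ ∷ []
legendre (suc (suc n)) =
  (+ (2 ℕ.* n ℕ.+ 3) ℚ./ (2 ℕ.+ n)) ℚ[x].·ₚ (0ℚ ∷ legendre (suc n))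
  ℚ[x].+ₚ (ℚ.- (+ (suc n) ℚ./ (2 ℕ.+ n))) ℚ[x].·ₚ legendre n

_ : legendre 2 ≡ -½ ∷ 0ℚ ∷ + 3 ℚ./ 2 ∷ []
_ = refl

_ : legendre 3 ≡ 0ℚ ∷ ℚ.- (+ 3 ℚ./ 2) ∷ 0ℚ ∷ + 5 ℚ./ 2 ∷ []
_ = refl

-- Irreflexivity of _#_ already forces 0# ≉ 1# in a HeytingField.
record FiniteField (q : ℕ) c ℓ₁ ℓ₂ : Set (L.suc (c ⊔ ℓ₁ ⊔ ℓ₂)) where
  field
    heytingField : HeytingField c ℓ₁ ℓ₂

  open HeytingField heytingField public
  open HeytingCommutativeRing heytingCommutativeRing public using (commutativeRing)
  open CommutativeRing commutativeRing public using (rawRing; semiring)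

  field
    enumeration : Inverse (CommutativeRing.setoid commutativeRing) (≡.setoid (Fin q))

  _≟_ : Decidable _≈_
  _≟_ = inj⇒≟ (Inverse⇒Injection enumeration)

  open RawSemiringDefs (Semiring.rawSemiring semiring) public using (_^_; _×_)
  open Polynomial commutativeRing public

  infix  9 _⁻¹
  infixr 8 _^ℤ_

  -- Total inverse, with 0# ⁻¹ = 0#.
  _⁻¹ : Carrier → Carrier
  x ⁻¹ with any? (λ k → (x * Inverse.from enumeration k) ≟ 1#)
  ... | yes (k , _) = Inverse.from enumeration k
  ... | no  _       = 0#

  _^ℤ_ : Carrier → ℤ → Carrier
  x ^ℤ (+ n)    = x ^ n
  x ^ℤ -[1+ n ] = (x ⁻¹) ^ suc n

  fromℤ : ℤ → Carrier
  fromℤ (+ n)    = n × 1#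
  fromℤ -[1+ n ] = - (suc n × 1#)

  -- Reduction of a rational number; only meaningful when the characteristic
  -- does not divide its (lowest-terms) denominator.
  fromℚ : ℚ → Carrier
  fromℚ r = fromℤ (↥ r) * (↧ₙ r × 1#) ⁻¹

  -- Pₙ reduced to the field, evaluated at t. The denominators of Pₙ are powers
  -- of 2, so this is meaningful in every odd characteristic.
  evalLegendre : ℕ → Carrier → Carrier
  evalLegendre n t = eval (map fromℚ (legendre n)) t

{-# OPTIONS --safe #-}
module Submission where

-- Since f = X (X^2g + a X^g + b), the coefficient of X^(m + l g) in fᵐ is the coefficient
-- of yˡ in (y² + a y + b)ᵐ, and all other coefficients vanish. The substitution y = √b z
-- reduces (a , b) to (a / √b , 1) at the cost of a power of √b. For b = 1 and 2 m = −1 the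
-- power (y² − 2 t y + 1)ᵐ satisfies the differential equation of the Legendre generating
-- function (y² − 2 t y + 1)^(−1/2), so its coefficients satisfy Bonnet's recurrence, whose
-- denominators are invertible up to degree p − 1.

open import Defs
open import Algebra.Bundles using (CommutativeRing)
open import Algebra.Morphism.Structures using (module RingMorphisms)
import Algebra.Properties.Semiring.Mult as SemiringMult
open import Data.Fin.Base using (Fin; toℕ)
open import Data.Fin.Permutation using (Permutation; permutation)
open import Data.Fin.Properties using (any?; toℕ<n)
open import Data.Integer.Base as ℤ using (ℤ; +_; -[1+_])
open import Data.Integer.DivMod using (_/ℕ_)
open import Data.Integer.Divisibility using (_∣_)
import Data.Integer.Properties as ℤ
open import Data.List.Base using (List; []; _∷_; map)
open import Data.Nat.Base as ℕ using (ℕ; zero; suc; NonZero; z≤n; s≤s)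
import Data.Nat.Coprimality as Coprimality
import Data.Nat.DivMod as ℕ
open import Data.Nat.Divisibility as ℕ using (divides)
open import Data.Nat.GCD using (gcd; module Bézout)
open import Data.Nat.Primality using (Prime; prime⇒irreducible)
import Data.Nat.Properties as ℕ
open import Data.Nat.Solver using (module +-*-Solver)
open import Data.Product.Base using (_×_; _,_; proj₁; proj₂; Σ-syntax)
open import Data.Rational.Base as ℚ using (ℚ; 0ℚ; 1ℚ; mkℚ; toℚᵘ)
import Data.Rational.Properties as ℚ
open import Data.Rational.Unnormalised.Base as ℚᵘ using (ℚᵘ; mkℚᵘ; *≡*)
import Data.Rational.Unnormalised.Properties as ℚᵘ
open import Data.Sum.Base using (inj₂)
open import Function.Bundles using (Inverse)
open import Level using (Level; _⊔_)
open import Relation.Binary.PropositionalEquality as ≡ using (_≡_; _≢_)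
open import Relation.Nullary using (¬_; yes; no; contradiction)

-- Two bounds on l carry the argument. The number k - m = ip - j - m lies strictly between -g and
-- gp, so divisibility by g gives 0 ≤ l ≤ p - 1. In this range Bonnet's recurrence divides only by
-- units modulo p, and the exponent 2m - l of √b is nonnegative. That exponent comes from comparing
-- coefficients of yˡ: √b^l times the entry for (a, b) is (√b²)^m times the entry for (a / √b, 1).
-- The relation 2m = -1 needs p = 0 in the field; this is extracted from the number of its elements.
-- Legendre polynomials live over ℚ, where reduction modulo p is only partially meaningful, so
-- `fromℚ` cannot be treated as a ring homomorphism. The relation `_↦_` replaces it: it is closed
-- under sums and products and is compared with `fromℚ` only at the end. The ring solver has natural
-- coefficients and no subtraction, so relations such as 1 + 2m = 0 and α + 2t = 0 are stated as
-- vanishing sums.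

private
  variable
    c ℓ ℓ₁ ℓ₂ c′ ℓ′ : Level

-- Power series as coefficient sequences, and powers of a quadratic.

module Sequence (R : CommutativeRing c ℓ) where
  open CommutativeRing R
  open Polynomial R using (coeff)
  open SemiringMult semiring using () renaming (_×_ to _·ℕ_)
  open import Algebra.Properties.Semiring.Exp semiring using (_^_)
  open import Algebra.Solver.Ring.NaturalCoefficients.Default commutativeSemiring
  open import Relation.Binary.Reasoning.Setoid setoid

  -- Multiplication by the k-th power of the variable. Series are functions of the exponent, so
  -- trailing zeros and degree bounds never interfere.
  shift : ℕ → (ℕ → Carrier) → ℕ → Carrier
  shift zero    u n       = u n
  shift (suc k) u zero    = 0#
  shift (suc k) u (suc n) = shift k u n

  shift-cong : ∀ k {u v} → (∀ n → u n ≈ v n) → ∀ n → shift k u n ≈ shift k v n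
  shift-cong zero    u≈v n       = u≈v n
  shift-cong (suc k) u≈v zero    = refl
  shift-cong (suc k) u≈v (suc n) = shift-cong k u≈v n

  shift-+ : ∀ j k u n → shift (j ℕ.+ k) u n ≡ shift j (shift k u) n
  shift-+ zero    k u n       = ≡.refl
  shift-+ (suc j) k u zero    = ≡.refl
  shift-+ (suc j) k u (suc n) = shift-+ j k u n

  shift-< : ∀ k u n → n ℕ.< k → shift k u n ≡ 0#
  shift-< (suc k) u zero    _   = ≡.refl
  shift-< (suc k) u (suc n) n<k = shift-< k u n (ℕ.s<s⁻¹ n<k)

  shift-≥ : ∀ k u n → shift k u (k ℕ.+ n) ≡ u n
  shift-≥ zero    u n = ≡.refl
  shift-≥ (suc k) u n = shift-≥ k u n

  module _ (α β : Carrier) where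

    -- Multiplication of a power series in y by y² + α y + β.
    quadratic : (ℕ → Carrier) → ℕ → Carrier
    quadratic u l = shift 2 u l + α * shift 1 u l + β * u l

    -- Coefficients of (y² + α y + β)ᵐ, built one factor at a time so that induction on m runs
    -- parallel to `_^ₚ_`.
    trinomial : ℕ → ℕ → Carrier
    trinomial zero    = coeff (1# ∷ [])
    trinomial (suc m) = quadratic (trinomial m)

    -- Multiplication by the derivative 2 y + α of the quadratic.
    linear : (ℕ → Carrier) → ℕ → Carrier
    linear u l = (1# + 1#) * shift 1 u l + α * u l

    derivative : (ℕ → Carrier) → ℕ → Carrier
    derivative u l = (suc l ·ℕ 1#) * u (suc l)

    quadratic-cong : ∀ {u v} → (∀ l → u l ≈ v l) → ∀ l → quadratic u l ≈ quadratic v l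
    quadratic-cong u≈v l = +-cong (+-cong (shift-cong 2 u≈v l) (*-congˡ (shift-cong 1 u≈v l)))
                                  (*-congˡ (u≈v l))

    quadratic-scale : ∀ x u l → quadratic (λ l → x * u l) l ≈ x * quadratic u l
    quadratic-scale x u zero = solve 4 (λ a b x u₀ →
      con 0 :+ a :* con 0 :+ b :* (x :* u₀) := x :* (con 0 :+ a :* con 0 :+ b :* u₀))
      refl α β x (u 0)
    quadratic-scale x u (suc zero) = solve 5 (λ a b x u₀ u₁ →
      con 0 :+ a :* (x :* u₀) :+ b :* (x :* u₁) := x :* (con 0 :+ a :* u₀ :+ b :* u₁))
      refl α β x (u 0) (u 1)
    quadratic-scale x u (suc (suc l)) = solve 6 (λ a b x u₀ u₁ u₂ →
      x :* u₀ :+ a :* (x :* u₁) :+ b :* (x :* u₂) := x :* (u₀ :+ a :* u₁ :+ b :* u₂))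
      refl α β x (u l) (u (suc l)) (u (suc (suc l)))

    -- Multiplications by two polynomials commute. The cases are those in which the shifts compute:
    -- the product is cubic, so it reaches back at most three coefficients.
    linear-quadratic : ∀ u l → quadratic (linear u) l ≈ linear (quadratic u) l
    linear-quadratic u zero = solve 3 (λ a b u₀ →
      con 0 :+ a :* con 0 :+ b :* ((con 1 :+ con 1) :* con 0 :+ a :* u₀) :=
      (con 1 :+ con 1) :* con 0 :+ a :* (con 0 :+ a :* con 0 :+ b :* u₀))
      refl α β (u 0)
    linear-quadratic u (suc zero) = solve 4 (λ a b u₀ u₁ →
      con 0 :+ a :* ((con 1 :+ con 1) :* con 0 :+ a :* u₀)
        :+ b :* ((con 1 :+ con 1) :* u₀ :+ a :* u₁) :=
      (con 1 :+ con 1) :* (con 0 :+ a :* con 0 :+ b :* u₀)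
        :+ a :* (con 0 :+ a :* u₀ :+ b :* u₁))
      refl α β (u 0) (u 1)
    linear-quadratic u (suc (suc zero)) = solve 5 (λ a b u₀ u₁ u₂ →
      ((con 1 :+ con 1) :* con 0 :+ a :* u₀) :+ a :* ((con 1 :+ con 1) :* u₀ :+ a :* u₁)
        :+ b :* ((con 1 :+ con 1) :* u₁ :+ a :* u₂) :=
      (con 1 :+ con 1) :* (con 0 :+ a :* u₀ :+ b :* u₁)
        :+ a :* (u₀ :+ a :* u₁ :+ b :* u₂))
      refl α β (u 0) (u 1) (u 2)
    linear-quadratic u (suc (suc (suc l))) = solve 6 (λ a b u₀ u₁ u₂ u₃ →
      ((con 1 :+ con 1) :* u₀ :+ a :* u₁) :+ a :* ((con 1 :+ con 1) :* u₁ :+ a :* u₂)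
        :+ b :* ((con 1 :+ con 1) :* u₂ :+ a :* u₃) :=
      (con 1 :+ con 1) :* (u₀ :+ a :* u₁ :+ b :* u₂)
        :+ a :* (u₁ :+ a :* u₂ :+ b :* u₃))
      refl α β (u l) (u (suc l)) (u (suc (suc l))) (u (suc (suc (suc l))))

    -- Product rule for Q U, with Q = y² + α y + β and Q′ = 2 y + α.
    leibniz : ∀ u l → derivative (quadratic u) l ≈ quadratic (derivative u) l + linear u l
    leibniz u zero = solve 4 (λ a b u₀ u₁ →
      (con 1 :+ con 0) :* (con 0 :+ a :* u₀ :+ b :* u₁) :=
      con 0 :+ a :* con 0 :+ b :* ((con 1 :+ con 0) :* u₁)
        :+ ((con 1 :+ con 1) :* con 0 :+ a :* u₀))
      refl α β (u 0) (u 1)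
    leibniz u (suc zero) = solve 5 (λ a b u₀ u₁ u₂ →
      (con 1 :+ (con 1 :+ con 0)) :* (u₀ :+ a :* u₁ :+ b :* u₂) :=
      con 0 :+ a :* ((con 1 :+ con 0) :* u₁) :+ b :* ((con 1 :+ (con 1 :+ con 0)) :* u₂)
        :+ ((con 1 :+ con 1) :* u₀ :+ a :* u₁))
      refl α β (u 0) (u 1) (u 2)
    leibniz u (suc (suc l)) = solve 6 (λ a b n u₁ u₂ u₃ →
      (con 1 :+ (con 1 :+ (con 1 :+ n))) :* (u₁ :+ a :* u₂ :+ b :* u₃) :=
      (con 1 :+ n) :* u₁ :+ a :* ((con 1 :+ (con 1 :+ n)) :* u₂)
        :+ b :* ((con 1 :+ (con 1 :+ (con 1 :+ n))) :* u₃)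
        :+ ((con 1 :+ con 1) :* u₁ :+ a :* u₂))
      refl α β (l ·ℕ 1#) (u (suc l)) (u (suc (suc l))) (u (suc (suc (suc l))))

    -- (y² + α y + β) U′ = m (2 y + α) U for U = (y² + α y + β)ᵐ.
    trinomial-ode : ∀ m l → quadratic (derivative (trinomial m)) l ≈
                            (m ·ℕ 1#) * linear (trinomial m) l
    trinomial-ode zero l = begin
      quadratic (derivative (trinomial 0)) l
        -- The derivative of 1 vanishes; 0 is written as 0 · 0 so that `quadratic-scale` can pull
        -- out a factor 0.
        ≈⟨ quadratic-cong (λ k → trans (zeroʳ _) (sym (zeroˡ 0#))) l ⟩
      quadratic (λ _ → 0# * 0#) l
        ≈⟨ quadratic-scale 0# (λ _ → 0#) l ⟩
      0# * quadratic (λ _ → 0#) l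
        ≈⟨ trans (zeroˡ _) (sym (zeroˡ _)) ⟩
      0# * linear (trinomial 0) l ∎
    trinomial-ode (suc m) l = begin
      quadratic (derivative (quadratic u)) l
        ≈⟨ quadratic-cong step l ⟩
      quadratic (λ l → (suc m ·ℕ 1#) * linear u l) l
        ≈⟨ quadratic-scale (suc m ·ℕ 1#) (linear u) l ⟩
      (suc m ·ℕ 1#) * quadratic (linear u) l
        ≈⟨ *-congˡ (linear-quadratic u l) ⟩
      (suc m ·ℕ 1#) * linear (quadratic u) l ∎
      where
      u = trinomial m
      -- By the induction hypothesis (Q U)′ = Q U′ + Q′ U = (m + 1) Q′ U; multiplying by Q and
      -- moving it past Q′ gives the equation for Q U.
      step : ∀ l → derivative (quadratic u) l ≈ (suc m ·ℕ 1#) * linear u l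
      step l = begin
        derivative (quadratic u) l                       ≈⟨ leibniz u l ⟩
        quadratic (derivative u) l + linear u l          ≈⟨ +-congʳ (trinomial-ode m l) ⟩
        (m ·ℕ 1#) * linear u l + linear u l              ≈⟨ solve 2 (λ n x → n :* x :+ x := (con 1 :+ n) :* x) refl _ _ ⟩
        (suc m ·ℕ 1#) * linear u l                       ∎

  -- The substitution y = s z.
  trinomial-homogeneous : ∀ {a b α β s} → a ≈ s * α → b ≈ s * s * β → ∀ m l →
    trinomial a b m l * s ^ l ≈ (s * s) ^ m * trinomial α β m l
  trinomial-homogeneous _ _ zero zero = refl
  trinomial-homogeneous _ _ zero (suc l) = trans (zeroˡ _) (sym (zeroʳ _))
  trinomial-homogeneous {a} {b} {α} {β} {s} a≈ b≈ (suc m) zero = begin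
    (0# + a * 0# + b * u 0) * 1#
      ≈⟨ *-congʳ (+-congˡ (*-congʳ b≈)) ⟩
    (0# + a * 0# + s * s * β * u 0) * 1#
      ≈⟨ solve 4 (λ a s β u → (con 0 :+ a :* con 0 :+ s :* s :* β :* u) :* con 1 := s :* s :* β :* (u :* con 1)) refl a s β (u 0) ⟩
    s * s * β * (u 0 * 1#)
      ≈⟨ *-congˡ (trinomial-homogeneous a≈ b≈ m 0) ⟩
    s * s * β * (P * v 0)
      ≈⟨ solve 5 (λ a s β p v → s :* s :* β :* (p :* v) := s :* s :* p :* (con 0 :+ a :* con 0 :+ β :* v)) refl α s β P (v 0) ⟩
    s * s * P * (0# + α * 0# + β * v 0) ∎
    where u = trinomial a b m; v = trinomial α β m; P = (s * s) ^ m
  trinomial-homogeneous {a} {b} {α} {β} {s} a≈ b≈ (suc m) (suc zero) = begin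
    (0# + a * u 0 + b * u 1) * (s * 1#)
      ≈⟨ *-congʳ (+-cong (+-congˡ (*-congʳ a≈)) (*-congʳ b≈)) ⟩
    (0# + s * α * u 0 + s * s * β * u 1) * (s * 1#)
      ≈⟨ solve 5 (λ a s β u₀ u₁ →
           (con 0 :+ s :* a :* u₀ :+ s :* s :* β :* u₁) :* (s :* con 1) :=
           s :* s :* (a :* (u₀ :* con 1) :+ β :* (u₁ :* (s :* con 1)))) refl α s β (u 0) (u 1) ⟩
    s * s * (α * (u 0 * 1#) + β * (u 1 * (s * 1#)))
      ≈⟨ *-congˡ (+-cong (*-congˡ (trinomial-homogeneous a≈ b≈ m 0)) (*-congˡ (trinomial-homogeneous a≈ b≈ m 1))) ⟩
    s * s * (α * (P * v 0) + β * (P * v 1))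
      ≈⟨ solve 6 (λ a s β p v₀ v₁ →
           s :* s :* (a :* (p :* v₀) :+ β :* (p :* v₁)) :=
           s :* s :* p :* (con 0 :+ a :* v₀ :+ β :* v₁)) refl α s β P (v 0) (v 1) ⟩
    s * s * P * (0# + α * v 0 + β * v 1) ∎
    where u = trinomial a b m; v = trinomial α β m; P = (s * s) ^ m
  trinomial-homogeneous {a} {b} {α} {β} {s} a≈ b≈ (suc m) (suc (suc l)) = begin
    (u l + a * u (suc l) + b * u (2 ℕ.+ l)) * (s * (s * s ^ l))
      ≈⟨ *-congʳ (+-cong (+-congˡ (*-congʳ a≈)) (*-congʳ b≈)) ⟩
    (u l + s * α * u (suc l) + s * s * β * u (2 ℕ.+ l)) * (s * (s * s ^ l))
      -- Every term yields s²: from the power of s for `u l`, one s each from `a` and from the power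
      -- for `u (suc l)`, and from `b` for the last. The power of s left over matches the index of
      -- its coefficient.
      ≈⟨ solve 7 (λ a s β u₀ u₁ u₂ S →
           (u₀ :+ s :* a :* u₁ :+ s :* s :* β :* u₂) :* (s :* (s :* S)) :=
           s :* s :* (u₀ :* S :+ a :* (u₁ :* (s :* S)) :+ β :* (u₂ :* (s :* (s :* S)))))
           refl α s β (u l) (u (suc l)) (u (2 ℕ.+ l)) (s ^ l) ⟩
    s * s * (u l * s ^ l + α * (u (suc l) * s ^ suc l) + β * (u (2 ℕ.+ l) * s ^ (2 ℕ.+ l)))
      ≈⟨ *-congˡ (+-cong (+-cong (trinomial-homogeneous a≈ b≈ m l)
                                 (*-congˡ (trinomial-homogeneous a≈ b≈ m (suc l))))
                         (*-congˡ (trinomial-homogeneous a≈ b≈ m (2 ℕ.+ l)))) ⟩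
    s * s * (P * v l + α * (P * v (suc l)) + β * (P * v (2 ℕ.+ l)))
      ≈⟨ solve 7 (λ a s β p v₀ v₁ v₂ →
           s :* s :* (p :* v₀ :+ a :* (p :* v₁) :+ β :* (p :* v₂)) :=
           s :* s :* p :* (v₀ :+ a :* v₁ :+ β :* v₂)) refl α s β P (v l) (v (suc l)) (v (2 ℕ.+ l)) ⟩
    s * s * P * (v l + α * v (suc l) + β * v (2 ℕ.+ l)) ∎
    where u = trinomial a b m; v = trinomial α β m; P = (s * s) ^ m

-- Coefficients of powers of the curve polynomial.

module CurvePower (R : CommutativeRing c ℓ) where
  open CommutativeRing R
  open Polynomial R
  open Sequence R
  open import Relation.Binary.Reasoning.Setoid setoid
  open import Algebra.Properties.CommutativeSemigroup +-commutativeSemigroup using (interchange)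

  coeff-+ₚ : ∀ f h n → coeff (f +ₚ h) n ≈ coeff f n + coeff h n
  coeff-+ₚ []      h       n       = sym (+-identityˡ _)
  coeff-+ₚ (x ∷ f) []      n       = sym (+-identityʳ _)
  coeff-+ₚ (x ∷ f) (y ∷ h) zero    = refl
  coeff-+ₚ (x ∷ f) (y ∷ h) (suc n) = coeff-+ₚ f h n

  coeff-·ₚ : ∀ x f n → coeff (x ·ₚ f) n ≈ x * coeff f n
  coeff-·ₚ x []      n       = sym (zeroʳ x)
  coeff-·ₚ x (y ∷ f) zero    = refl
  coeff-·ₚ x (y ∷ f) (suc n) = coeff-·ₚ x f n

  coeff-∷-*ₚ : ∀ x f h n →
    coeff ((x ∷ f) *ₚ h) n ≈ x * coeff h n + coeff (0# ∷ f *ₚ h) n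
  coeff-∷-*ₚ x f h n = trans (coeff-+ₚ (x ·ₚ h) _ n) (+-congʳ (coeff-·ₚ x h n))

  coeff-+ₚ-*ₚ : ∀ f f′ h n → coeff ((f +ₚ f′) *ₚ h) n ≈ coeff (f *ₚ h) n + coeff (f′ *ₚ h) n
  coeff-+ₚ-*ₚ []      f′       h n = sym (+-identityˡ _)
  coeff-+ₚ-*ₚ (x ∷ f) []       h n = sym (+-identityʳ _)
  coeff-+ₚ-*ₚ (x ∷ f) (y ∷ f′) h n = begin
    coeff ((x + y ∷ f +ₚ f′) *ₚ h) n
      ≈⟨ coeff-∷-*ₚ (x + y) (f +ₚ f′) h n ⟩
    (x + y) * coeff h n + coeff (0# ∷ (f +ₚ f′) *ₚ h) n
      ≈⟨ +-cong (distribʳ _ x y) (tail n) ⟩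
    (x * coeff h n + y * coeff h n) + (coeff (0# ∷ f *ₚ h) n + coeff (0# ∷ f′ *ₚ h) n)
      ≈⟨ interchange _ _ _ _ ⟩
    (x * coeff h n + coeff (0# ∷ f *ₚ h) n) + (y * coeff h n + coeff (0# ∷ f′ *ₚ h) n)
      ≈⟨ +-cong (coeff-∷-*ₚ x f h n) (coeff-∷-*ₚ y f′ h n) ⟨
    coeff ((x ∷ f) *ₚ h) n + coeff ((y ∷ f′) *ₚ h) n ∎
    where
    tail : ∀ n → coeff (0# ∷ (f +ₚ f′) *ₚ h) n ≈
                 coeff (0# ∷ f *ₚ h) n + coeff (0# ∷ f′ *ₚ h) n
    tail zero    = sym (+-identityˡ 0#)
    tail (suc n) = coeff-+ₚ-*ₚ f f′ h n

  coeff-·ₚ-*ₚ : ∀ x f h n → coeff ((x ·ₚ f) *ₚ h) n ≈ x * coeff (f *ₚ h) n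
  coeff-·ₚ-*ₚ x []      h n = sym (zeroʳ x)
  coeff-·ₚ-*ₚ x (y ∷ f) h n = begin
    coeff ((x * y ∷ x ·ₚ f) *ₚ h) n
      ≈⟨ coeff-∷-*ₚ (x * y) (x ·ₚ f) h n ⟩
    x * y * coeff h n + coeff (0# ∷ (x ·ₚ f) *ₚ h) n
      ≈⟨ +-cong (*-assoc x y _) (tail n) ⟩
    x * (y * coeff h n) + x * coeff (0# ∷ f *ₚ h) n
      ≈⟨ distribˡ x _ _ ⟨
    x * (y * coeff h n + coeff (0# ∷ f *ₚ h) n)
      ≈⟨ *-congˡ (coeff-∷-*ₚ y f h n) ⟨
    x * coeff ((y ∷ f) *ₚ h) n ∎
    where
    tail : ∀ n → coeff (0# ∷ (x ·ₚ f) *ₚ h) n ≈ x * coeff (0# ∷ f *ₚ h) n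
    tail zero    = sym (zeroʳ x)
    tail (suc n) = coeff-·ₚ-*ₚ x f h n

  coeff-X^-*ₚ : ∀ k h n → coeff ((X^ k) *ₚ h) n ≈ shift k (coeff h) n
  coeff-X^-*ₚ zero h n = begin
    coeff ((1# ∷ []) *ₚ h) n               ≈⟨ coeff-∷-*ₚ 1# [] h n ⟩
    1# * coeff h n + coeff (0# ∷ []) n     ≈⟨ +-cong (*-identityˡ _) (tail n) ⟩
    coeff h n + 0#                         ≈⟨ +-identityʳ _ ⟩
    coeff h n                              ∎
    where
    tail : ∀ n → coeff (0# ∷ []) n ≈ 0#
    tail zero    = refl
    tail (suc n) = refl
  coeff-X^-*ₚ (suc k) h n = begin
    coeff ((0# ∷ X^ k) *ₚ h) n                       ≈⟨ coeff-∷-*ₚ 0# (X^ k) h n ⟩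
    0# * coeff h n + coeff (0# ∷ (X^ k) *ₚ h) n      ≈⟨ +-cong (zeroˡ _) (tail n) ⟩
    0# + shift (suc k) (coeff h) n                   ≈⟨ +-identityˡ _ ⟩
    shift (suc k) (coeff h) n                        ∎
    where
    tail : ∀ n → coeff (0# ∷ (X^ k) *ₚ h) n ≈ shift (suc k) (coeff h) n
    tail zero    = refl
    tail (suc n) = coeff-X^-*ₚ k h n

  coeff-curve-*ₚ : ∀ g a b h n → coeff (curve g a b *ₚ h) n ≈
    shift (2 ℕ.* g ℕ.+ 1) (coeff h) n + a * shift (g ℕ.+ 1) (coeff h) n + b * shift 1 (coeff h) n
  coeff-curve-*ₚ g a b h n = begin
    coeff (curve g a b *ₚ h) n
      ≈⟨ coeff-+ₚ-*ₚ (X^ (2 ℕ.* g ℕ.+ 1) +ₚ a ·ₚ X^ (g ℕ.+ 1)) (b ·ₚ X^ 1) h n ⟩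
    coeff ((X^ (2 ℕ.* g ℕ.+ 1) +ₚ a ·ₚ X^ (g ℕ.+ 1)) *ₚ h) n + coeff ((b ·ₚ X^ 1) *ₚ h) n
      ≈⟨ +-cong (coeff-+ₚ-*ₚ (X^ (2 ℕ.* g ℕ.+ 1)) (a ·ₚ X^ (g ℕ.+ 1)) h n) (scaled b 1) ⟩
    coeff ((X^ (2 ℕ.* g ℕ.+ 1)) *ₚ h) n + coeff ((a ·ₚ X^ (g ℕ.+ 1)) *ₚ h) n
      + b * shift 1 (coeff h) n
      ≈⟨ +-congʳ (+-cong (coeff-X^-*ₚ (2 ℕ.* g ℕ.+ 1) h n) (scaled a (g ℕ.+ 1))) ⟩
    _ ∎
    where
    scaled : ∀ x k → coeff ((x ·ₚ X^ k) *ₚ h) n ≈ x * shift k (coeff h) n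
    scaled x k = trans (coeff-·ₚ-*ₚ x (X^ k) h n) (*-congˡ (coeff-X^-*ₚ k h n))

  module _ (g : ℕ) .{{_ : NonZero g}} where

    -- u is the coefficient sequence of Xᵐ v(X^g).
    Spread : ℕ → (ℕ → Carrier) → (ℕ → Carrier) → Set _
    Spread m u v = (∀ l → u (m ℕ.+ l ℕ.* g) ≈ v l)
                 × (∀ n → (∀ l → n ≢ m ℕ.+ l ℕ.* g) → u n ≈ 0#)

    Spread-+ : ∀ {m u v u′ v′} → Spread m u v → Spread m u′ v′ →
               Spread m (λ n → u n + u′ n) (λ l → v l + v′ l)
    Spread-+ (on , off) (on′ , off′) =
      (λ l → +-cong (on l) (on′ l)) ,
      (λ n n≢ → trans (+-cong (off n n≢) (off′ n n≢)) (+-identityˡ 0#))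

    Spread-* : ∀ {m u v} x → Spread m u v → Spread m (λ n → x * u n) (λ l → x * v l)
    Spread-* x (on , off) =
      (λ l → *-congˡ (on l)) , (λ n n≢ → trans (*-congˡ (off n n≢)) (zeroʳ x))

    Spread-shift-1 : ∀ {m u v} → Spread m u v → Spread (suc m) (shift 1 u) v
    Spread-shift-1 {m} {u} (on , off) = on , off₁
      where
      off₁ : ∀ n → (∀ l → n ≢ suc m ℕ.+ l ℕ.* g) → shift 1 u n ≈ 0#
      off₁ zero    _  = refl
      off₁ (suc n) n≢ = off n (λ l n≡ → n≢ l (≡.cong suc n≡))

    -- As y stands for X^g, multiplication by X^g acts on v and leaves the offset m in place,
    -- whereas multiplication by X moves only the offset.
    Spread-shift-g : ∀ {m u v} → Spread m u v → Spread m (shift g u) (shift 1 v)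
    Spread-shift-g {m} {u} {v} (on , off) = on₁ , off₁
      where
      swap : ∀ l → g ℕ.+ (m ℕ.+ l ℕ.* g) ≡ m ℕ.+ suc l ℕ.* g
      swap l = solve 3 (λ g m x → g :+ (m :+ x) := m :+ (g :+ x)) ≡.refl g m (l ℕ.* g)
        where open +-*-Solver

      -- Stated for exponents not of the form g + (m + l g), this covers both those off the
      -- progression and its first member m, where y v(y) has constant term 0.
      below : ∀ n → (∀ l → n ≢ g ℕ.+ (m ℕ.+ l ℕ.* g)) → shift g u n ≈ 0#
      below n n≢ with n ℕ.<? g
      ... | yes n<g = reflexive (shift-< g u n n<g)
      ... | no  n≮g = begin
        shift g u n                    ≡⟨ ≡.cong (shift g u) n≡ ⟨
        shift g u (g ℕ.+ (n ℕ.∸ g))    ≡⟨ shift-≥ g u (n ℕ.∸ g) ⟩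
        u (n ℕ.∸ g)                    ≈⟨ off _ (λ l eq → n≢ l (≡.trans (≡.sym n≡) (≡.cong (g ℕ.+_) eq))) ⟩
        0#                             ∎
        where
        n≡ : g ℕ.+ (n ℕ.∸ g) ≡ n
        n≡ = ℕ.m+[n∸m]≡n (ℕ.≮⇒≥ n≮g)

      on₁ : ∀ l → shift g u (m ℕ.+ l ℕ.* g) ≈ shift 1 v l
      on₁ zero = below _ (λ l eq → ℕ.<⇒≢ (≡.subst (m ℕ.+ 0 ℕ.<_) (≡.sym (swap l))
        (ℕ.+-monoʳ-< m (ℕ.<-≤-trans (ℕ.>-nonZero⁻¹ g) (ℕ.m≤m+n g _)))) eq)
      on₁ (suc l) = begin
        shift g u (m ℕ.+ suc l ℕ.* g)          ≡⟨ ≡.cong (shift g u) (swap l) ⟨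
        shift g u (g ℕ.+ (m ℕ.+ l ℕ.* g))      ≡⟨ shift-≥ g u _ ⟩
        u (m ℕ.+ l ℕ.* g)                      ≈⟨ on l ⟩
        v l                                    ∎

      off₁ : ∀ n → (∀ l → n ≢ m ℕ.+ l ℕ.* g) → shift g u n ≈ 0#
      off₁ n n≢ = below n (λ l eq → n≢ (suc l) (≡.trans eq (swap l)))

    Spread-cong : ∀ {m u u′ v v′} → (∀ n → u n ≈ u′ n) → (∀ l → v′ l ≈ v l) →
                  Spread m u′ v′ → Spread m u v
    Spread-cong u≈ v≈ (on , off) =
      (λ l → trans (u≈ _) (trans (on l) (v≈ l))) , (λ n n≢ → trans (u≈ n) (off n n≢))

    curve-^ₚ-Spread : ∀ a b m → Spread m (coeff (curve g a b ^ₚ m)) (trinomial a b m)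
    curve-^ₚ-Spread a b zero = on , off
      where
      on : ∀ l → coeff (1# ∷ []) (l ℕ.* g) ≈ coeff (1# ∷ []) l
      on zero    = refl
      on (suc l) = reflexive (vanish (ℕ.<-≤-trans (ℕ.>-nonZero⁻¹ g) (ℕ.m≤m+n g _)))
        where
        vanish : ∀ {n} → 0 ℕ.< n → coeff (1# ∷ []) n ≡ 0#
        vanish {suc n} _ = ≡.refl
      off : ∀ n → (∀ l → n ≢ l ℕ.* g) → coeff (1# ∷ []) n ≈ 0#
      off zero    n≢ = contradiction ≡.refl (n≢ 0)
      off (suc n) _  = refl
    curve-^ₚ-Spread a b (suc m) = Spread-cong
      (coeff-curve-*ₚ g a b (curve g a b ^ₚ m))
      (λ l → +-congʳ (+-congʳ (reflexive (≡.sym (shift-+ 1 1 v l)))))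
      -- Each monomial of the curve is X times 1, X^g or X^g X^g: the offset moves by one first,
      -- then powers of y act.
      (Spread-+ (Spread-+
        (Spread-cong two-shifts (λ _ → refl)
          (Spread-shift-g (Spread-shift-g shifted)))
        (Spread-* a (Spread-cong (λ n → reflexive (shift-+ g 1 u n)) (λ _ → refl)
          (Spread-shift-g shifted))))
        (Spread-* b shifted))
      where
      u = coeff (curve g a b ^ₚ m)
      v = trinomial a b m
      shifted = Spread-shift-1 (curve-^ₚ-Spread a b m)
      two-shifts : ∀ n → shift (2 ℕ.* g ℕ.+ 1) u n ≈ shift g (shift g (shift 1 u)) n
      two-shifts n = begin
        shift (2 ℕ.* g ℕ.+ 1) u n
          ≡⟨ ≡.cong (λ k → shift k u n) (solve 1 (λ g → con 2 :* g :+ con 1 := g :+ (g :+ con 1)) ≡.refl g) ⟩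
        shift (g ℕ.+ (g ℕ.+ 1)) u n
          ≡⟨ shift-+ g (g ℕ.+ 1) u n ⟩
        shift g (shift (g ℕ.+ 1) u) n
          ≈⟨ shift-cong g (λ n → reflexive (shift-+ g 1 u n)) n ⟩
        shift g (shift g (shift 1 u)) n ∎
        where open +-*-Solver

-- Inverses and characteristic of a finite field.

module FieldProperties {q : ℕ} (F : FiniteField q c ℓ₁ ℓ₂) where
  open FiniteField F using
    (commutativeRing; enumeration; _≟_; _⁻¹; #⇒invertible; #-irrefl; invertible⇒#; tight;
     fromℤ; fromℚ; eval; evalLegendre)
  open CommutativeRing commutativeRing
  open SemiringMult semiring using (×1-homo-*; ×-homo-+) renaming (_×_ to _·ℕ_)
  open import Algebra.Properties.CommutativeMonoid.Sum +-commutativeMonoid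
    using (sum; sum-cong-≋; ∑-distrib-+; sum-permute; sum-replicate)
  open import Algebra.Properties.Ring ring
    using (-0#≈0#; -‿involutive; -‿distribˡ-*; -‿distribʳ-*; -‿+-comm; +-cancelˡ)
  open import Algebra.Solver.Ring.NaturalCoefficients.Default commutativeSemiring
  open import Relation.Binary.Reasoning.Setoid setoid

  private
    module Enum = Inverse enumeration

  -- Otherwise 0 - 0 would be invertible, with inverse 0, and 0 would be apart from itself.
  1≉0 : 1# ≉ 0#
  1≉0 1≈0 = #-irrefl refl (invertible⇒# {0#} {0#}
    (0# , trans (zeroˡ _) (sym 1≈0) , trans (zeroʳ _) (sym 1≈0)))

  -- The inverse is found by searching the enumeration. Apartness from 0 supplies an inverse, so a
  -- failed search means that x is not apart from 0, and tightness then gives x ≈ 0.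
  *-inverseʳ : ∀ {x} → x ≉ 0# → x * x ⁻¹ ≈ 1#
  *-inverseʳ {x} x≉0 with any? (λ k → (x * Enum.from k) ≟ 1#)
  ... | yes (k , eq) = eq
  ... | no  none     = contradiction (proj₁ (tight x 0#) apart⇒⊥) x≉0
    where
    apart⇒⊥ : ¬ (FiniteField._#_ F x 0#)
    apart⇒⊥ x#0 with #⇒invertible x#0
    ... | y , _ , eq = none (Enum.to y , (begin
      x * Enum.from (Enum.to y)   ≈⟨ *-cong (sym (trans (+-congˡ -0#≈0#) (+-identityʳ x))) (Enum.strictlyInverseʳ y) ⟩
      (x - 0#) * y          ≈⟨ eq ⟩
      1#                    ∎))

  *-cancelʳ : ∀ {x y z} → x ≉ 0# → y * x ≈ z * x → y ≈ z
  *-cancelʳ {x} {y} {z} x≉0 eq = begin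
    y                ≈⟨ trans (*-congˡ (*-inverseʳ x≉0)) (*-identityʳ y) ⟨
    y * (x * x ⁻¹)   ≈⟨ *-assoc _ _ _ ⟨
    y * x * x ⁻¹     ≈⟨ *-congʳ eq ⟩
    z * x * x ⁻¹     ≈⟨ *-assoc _ _ _ ⟩
    z * (x * x ⁻¹)   ≈⟨ trans (*-congˡ (*-inverseʳ x≉0)) (*-identityʳ z) ⟩
    z                ∎

  x*y≉0 : ∀ {x y} → x ≉ 0# → y ≉ 0# → x * y ≉ 0#
  x*y≉0 x≉0 y≉0 xy≈0 = x≉0 (*-cancelʳ y≉0 (trans xy≈0 (sym (zeroˡ _))))

  x*y≉0⇒x≉0 : ∀ {x y} → x * y ≉ 0# → x ≉ 0#
  x*y≉0⇒x≉0 xy≉0 x≈0 = xy≉0 (trans (*-congʳ x≈0) (zeroˡ _))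

  ^-≉0 : ∀ {x} n → x ≉ 0# → FiniteField._^_ F x n ≉ 0#
  ^-≉0 zero    x≉0 = 1≉0
  ^-≉0 (suc n) x≉0 = x*y≉0 x≉0 (^-≉0 n x≉0)

  ·ℕ1-cong : ∀ {m n} → m ≡ n → m ·ℕ 1# ≈ n ·ℕ 1#
  ·ℕ1-cong m≡n = reflexive (≡.cong (_·ℕ 1#) m≡n)

  -- Translation by 1 permutes the field, so ∑ x = ∑ (x + 1) = ∑ x + q · 1.
  order·1≈0 : q ·ℕ 1# ≈ 0#
  order·1≈0 = +-cancelˡ (sum Enum.from) _ _ (begin
    sum Enum.from + q ·ℕ 1#                      ≈⟨ +-congˡ (sum-replicate q) ⟨
    sum Enum.from + sum {q} (λ _ → 1#)           ≈⟨ ∑-distrib-+ Enum.from (λ _ → 1#) ⟨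
    sum (λ k → Enum.from k + 1#)                 ≈⟨ sum-cong-≋ {q} (λ k → Enum.strictlyInverseʳ (Enum.from k + 1#)) ⟨
    sum (λ k → Enum.from (Enum.to (Enum.from k + 1#))) ≈⟨ sum-permute Enum.from translation ⟨
    sum Enum.from                                ≈⟨ +-identityʳ _ ⟨
    sum Enum.from + 0#                           ∎)
    where
    inverse : ∀ x y → x + y ≈ 0# → ∀ k → Enum.to (Enum.from (Enum.to (Enum.from k + x)) + y) ≡ k
    inverse x y x+y≈0 k = ≡.trans
      (Enum.to-cong (begin
        Enum.from (Enum.to (Enum.from k + x)) + y   ≈⟨ +-congʳ (Enum.strictlyInverseʳ _) ⟩
        Enum.from k + x + y                   ≈⟨ +-assoc _ _ _ ⟩
        Enum.from k + (x + y)                 ≈⟨ trans (+-congˡ x+y≈0) (+-identityʳ _) ⟩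
        Enum.from k                           ∎))
      (Enum.strictlyInverseˡ k)
    translation : Permutation q q
    translation = permutation (λ k → Enum.to (Enum.from k + 1#)) (λ k → Enum.to (Enum.from k - 1#))
      (inverse (- 1#) 1# (-‿inverseˡ 1#)) (inverse 1# (- 1#) (-‿inverseʳ 1#))

  -- A field has no zero divisors, so one factor m · 1 can be cancelled at a time. This descends
  -- from the order of the field to its characteristic p.
  ^·1≈0⇒·1≈0 : ∀ m k → (m ℕ.^ k) ·ℕ 1# ≈ 0# → m ·ℕ 1# ≈ 0#
  ^·1≈0⇒·1≈0 m zero    eq = contradiction (trans (sym (+-identityʳ 1#)) eq) 1≉0
  ^·1≈0⇒·1≈0 m (suc k) eq with (m ·ℕ 1#) ≟ 0#
  ... | yes m≈0 = m≈0
  ... | no  m≉0 = ^·1≈0⇒·1≈0 m k (*-cancelʳ m≉0 (begin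
    ((m ℕ.^ k) ·ℕ 1#) * (m ·ℕ 1#)   ≈⟨ *-comm _ _ ⟩
    (m ·ℕ 1#) * ((m ℕ.^ k) ·ℕ 1#)   ≈⟨ ×1-homo-* m (m ℕ.^ k) ⟨
    (m ℕ.^ suc k) ·ℕ 1#             ≈⟨ trans eq (sym (zeroˡ _)) ⟩
    0# * (m ·ℕ 1#)                  ∎))

  multiple·1≈0 : ∀ k {m} → m ·ℕ 1# ≈ 0# → (k ℕ.* m) ·ℕ 1# ≈ 0#
  multiple·1≈0 k m≈0 = trans (×1-homo-* k _) (trans (*-congˡ m≈0) (zeroʳ _))

  -- A Bézout identity between `suc k` and p would otherwise reduce to 1 ≈ 0.
  <p⇒·1≉0 : ∀ {p} → Prime p → p ·ℕ 1# ≈ 0# → ∀ k → suc k ℕ.< p → suc k ·ℕ 1# ≉ 0#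
  <p⇒·1≉0 {p} p-prime p≈0 k k<p k≈0
    with Coprimality.coprime-Bézout (Coprimality.prime⇒coprime p-prime k<p)
  ... | Bézout.+- x y eq = 1≉0 (begin
    1#                              ≈⟨ trans (+-congˡ (multiple·1≈0 y k≈0)) (+-identityʳ 1#) ⟨
    (1 ℕ.+ y ℕ.* suc k) ·ℕ 1#       ≈⟨ ·ℕ1-cong eq ⟩
    (x ℕ.* p) ·ℕ 1#                 ≈⟨ multiple·1≈0 x p≈0 ⟩
    0#                              ∎)
  ... | Bézout.-+ x y eq = 1≉0 (begin
    1#                              ≈⟨ trans (+-congˡ (multiple·1≈0 x p≈0)) (+-identityʳ 1#) ⟨
    (1 ℕ.+ x ℕ.* p) ·ℕ 1#           ≈⟨ ·ℕ1-cong eq ⟩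
    (y ℕ.* suc k) ·ℕ 1#             ≈⟨ multiple·1≈0 y k≈0 ⟩
    0#                              ∎)

  -- Reduction of integers and rationals.

  fromℤ-⊖ : ∀ m n → fromℤ (m ℤ.⊖ n) ≈ m ·ℕ 1# - n ·ℕ 1#
  fromℤ-⊖ m n with m ℕ.<? n
  ... | yes m<n = begin
    fromℤ (m ℤ.⊖ n)                      ≡⟨ ≡.cong fromℤ (ℤ.⊖-< m<n) ⟩
    fromℤ (ℤ.- + (n ℕ.∸ m))              ≈⟨ fromℤ-neg⁺ (n ℕ.∸ m) ⟩
    - ((n ℕ.∸ m) ·ℕ 1#)                  ≈⟨ +-identityˡ _ ⟨
    0# - (n ℕ.∸ m) ·ℕ 1#                 ≈⟨ +-congʳ (-‿inverseʳ (m ·ℕ 1#)) ⟨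
    m ·ℕ 1# - m ·ℕ 1# - (n ℕ.∸ m) ·ℕ 1#  ≈⟨ trans (+-assoc _ _ _) (+-congˡ (-‿+-comm _ _)) ⟩
    m ·ℕ 1# - (m ·ℕ 1# + (n ℕ.∸ m) ·ℕ 1#) ≈⟨ +-congˡ (-‿cong (×-homo-+ 1# m (n ℕ.∸ m))) ⟨
    m ·ℕ 1# - (m ℕ.+ (n ℕ.∸ m)) ·ℕ 1#    ≈⟨ +-congˡ (-‿cong (·ℕ1-cong (ℕ.m+[n∸m]≡n (ℕ.<⇒≤ m<n)))) ⟩
    m ·ℕ 1# - n ·ℕ 1#                    ∎
    where
    fromℤ-neg⁺ : ∀ k → fromℤ (ℤ.- + k) ≈ - (k ·ℕ 1#)
    fromℤ-neg⁺ zero    = sym -0#≈0#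
    fromℤ-neg⁺ (suc k) = refl
  ... | no m≮n = begin
    fromℤ (m ℤ.⊖ n)                      ≡⟨ ≡.cong fromℤ (ℤ.⊖-≥ n≤m) ⟩
    (m ℕ.∸ n) ·ℕ 1#                      ≈⟨ trans (+-congˡ (-‿inverseʳ (n ·ℕ 1#))) (+-identityʳ _) ⟨
    (m ℕ.∸ n) ·ℕ 1# + (n ·ℕ 1# - n ·ℕ 1#) ≈⟨ +-assoc _ _ _ ⟨
    (m ℕ.∸ n) ·ℕ 1# + n ·ℕ 1# - n ·ℕ 1#  ≈⟨ +-congʳ (×-homo-+ 1# (m ℕ.∸ n) n) ⟨
    (m ℕ.∸ n ℕ.+ n) ·ℕ 1# - n ·ℕ 1#      ≈⟨ +-congʳ (·ℕ1-cong (ℕ.m∸n+n≡m n≤m)) ⟩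
    m ·ℕ 1# - n ·ℕ 1#                    ∎
    where n≤m = ℕ.≮⇒≥ m≮n

  fromℤ-neg : ∀ i → fromℤ (ℤ.- i) ≈ - fromℤ i
  fromℤ-neg (+ zero)  = sym -0#≈0#
  fromℤ-neg (+ suc n) = refl
  fromℤ-neg -[1+ n ]  = sym (-‿involutive _)

  fromℤ-+ : ∀ i j → fromℤ (i ℤ.+ j) ≈ fromℤ i + fromℤ j
  fromℤ-+ (+ m)    (+ n)    = ×-homo-+ 1# m n
  fromℤ-+ (+ m)    -[1+ n ] = fromℤ-⊖ m (suc n)
  fromℤ-+ -[1+ m ] (+ n)    = trans (fromℤ-⊖ n (suc m)) (+-comm _ _)
  fromℤ-+ -[1+ m ] -[1+ n ] = begin
    - (suc (suc (m ℕ.+ n)) ·ℕ 1#)        ≈⟨ -‿cong (·ℕ1-cong (≡.cong suc (ℕ.+-suc m n))) ⟨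
    - ((suc m ℕ.+ suc n) ·ℕ 1#)          ≈⟨ -‿cong (×-homo-+ 1# (suc m) (suc n)) ⟩
    - (suc m ·ℕ 1# + suc n ·ℕ 1#)        ≈⟨ -‿+-comm _ _ ⟨
    - (suc m ·ℕ 1#) - suc n ·ℕ 1#        ∎

  fromℤ-*⁺ : ∀ m j → fromℤ (+ m ℤ.* j) ≈ (m ·ℕ 1#) * fromℤ j
  fromℤ-*⁺ zero    j = sym (zeroˡ _)
  fromℤ-*⁺ (suc m) j = begin
    fromℤ (+ suc m ℤ.* j)                 ≡⟨ ≡.cong fromℤ (ℤ.suc-* (+ m) j) ⟩
    fromℤ (j ℤ.+ + m ℤ.* j)               ≈⟨ fromℤ-+ j (+ m ℤ.* j) ⟩
    fromℤ j + fromℤ (+ m ℤ.* j)           ≈⟨ +-congˡ (fromℤ-*⁺ m j) ⟩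
    fromℤ j + (m ·ℕ 1#) * fromℤ j         ≈⟨ +-congʳ (*-identityˡ _) ⟨
    1# * fromℤ j + (m ·ℕ 1#) * fromℤ j    ≈⟨ distribʳ _ _ _ ⟨
    (suc m ·ℕ 1#) * fromℤ j               ∎

  fromℤ-* : ∀ i j → fromℤ (i ℤ.* j) ≈ fromℤ i * fromℤ j
  fromℤ-* (+ m)    j = fromℤ-*⁺ m j
  fromℤ-* -[1+ m ] j = begin
    fromℤ (-[1+ m ] ℤ.* j)            ≡⟨ ≡.cong fromℤ (ℤ.neg-distribˡ-* (+ suc m) j) ⟨
    fromℤ (ℤ.- (+ suc m ℤ.* j))       ≈⟨ fromℤ-neg (+ suc m ℤ.* j) ⟩
    - fromℤ (+ suc m ℤ.* j)           ≈⟨ -‿cong (fromℤ-*⁺ (suc m) j) ⟩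
    - ((suc m ·ℕ 1#) * fromℤ j)       ≈⟨ -‿distribˡ-* _ _ ⟩
    - (suc m ·ℕ 1#) * fromℤ j         ∎

  -- r reduces to x if some fraction representing r, not necessarily in lowest
  -- terms, has a denominator invertible in the field and reduces to x.
  record _↦_ (r : ℚ) (x : Carrier) : Set ℓ₁ where
    constructor reduces
    field
      fraction    : ℚᵘ
      represents  : toℚᵘ r ℚᵘ.≃ fraction
      denominator : ℚᵘ.↧ₙ fraction ·ℕ 1# ≉ 0#
      numerator   : fromℤ (ℚᵘ.↥ fraction) ≈ x * (ℚᵘ.↧ₙ fraction ·ℕ 1#)

  ↦-/ : ∀ n d {x} → suc d ·ℕ 1# ≉ 0# → fromℤ n ≈ x * (suc d ·ℕ 1#) → (n ℚ./ suc d) ↦ x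
  ↦-/ n d d≉0 n≈ = reduces (mkℚᵘ n d) (ℚ.toℚᵘ-fromℚᵘ (mkℚᵘ n d)) d≉0 n≈

  -- Addition in ℚ cancels common factors, which hides the resulting denominator. On unnormalised
  -- fractions it is the product of the two denominators, hence invertible.
  ↦-+ : ∀ {r s x y} → r ↦ x → s ↦ y → (r ℚ.+ s) ↦ (x + y)
  ↦-+ {r} {s} {x} {y} (reduces f@(mkℚᵘ a b-1) r≃ b≉0 a≈) (reduces g@(mkℚᵘ c d-1) s≃ d≉0 c≈) =
    reduces (f ℚᵘ.+ g)
      (ℚᵘ.≃-trans (ℚ.toℚᵘ-homo-+ r s) (ℚᵘ.+-cong r≃ s≃))
      (λ bd≈0 → x*y≉0 b≉0 d≉0 (trans (sym (×1-homo-* b d)) bd≈0))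
      (begin
        fromℤ (a ℤ.* + d ℤ.+ c ℤ.* + b)
          ≈⟨ trans (fromℤ-+ (a ℤ.* + d) (c ℤ.* + b)) (+-cong (fromℤ-* a (+ d)) (fromℤ-* c (+ b))) ⟩
        fromℤ a * (d ·ℕ 1#) + fromℤ c * (b ·ℕ 1#)
          ≈⟨ +-cong (*-congʳ a≈) (*-congʳ c≈) ⟩
        x * (b ·ℕ 1#) * (d ·ℕ 1#) + y * (d ·ℕ 1#) * (b ·ℕ 1#)
          ≈⟨ solve 4 (λ x y b d → x :* b :* d :+ y :* d :* b := (x :+ y) :* (b :* d)) refl x y _ _ ⟩
        (x + y) * ((b ·ℕ 1#) * (d ·ℕ 1#))
          ≈⟨ *-congˡ (×1-homo-* b d) ⟨
        (x + y) * ((b ℕ.* d) ·ℕ 1#) ∎)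
    where
    b = suc b-1
    d = suc d-1

  ↦-* : ∀ {r s x y} → r ↦ x → s ↦ y → (r ℚ.* s) ↦ (x * y)
  ↦-* {r} {s} {x} {y} (reduces f@(mkℚᵘ a b-1) r≃ b≉0 a≈) (reduces g@(mkℚᵘ c d-1) s≃ d≉0 c≈) =
    reduces (f ℚᵘ.* g)
      (ℚᵘ.≃-trans (ℚ.toℚᵘ-homo-* r s) (ℚᵘ.*-cong r≃ s≃))
      (λ bd≈0 → x*y≉0 b≉0 d≉0 (trans (sym (×1-homo-* b d)) bd≈0))
      (begin
        fromℤ (a ℤ.* c)
          ≈⟨ trans (fromℤ-* a c) (*-cong a≈ c≈) ⟩
        x * (b ·ℕ 1#) * (y * (d ·ℕ 1#))
          ≈⟨ solve 4 (λ x y b d → x :* b :* (y :* d) := x :* y :* (b :* d)) refl x y _ _ ⟩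
        x * y * ((b ·ℕ 1#) * (d ·ℕ 1#))
          ≈⟨ *-congˡ (×1-homo-* b d) ⟨
        x * y * ((b ℕ.* d) ·ℕ 1#) ∎)
    where
    b = suc b-1
    d = suc d-1

  ↦-neg : ∀ {r x} → r ↦ x → (ℚ.- r) ↦ (- x)
  ↦-neg {r} {x} (reduces f@(mkℚᵘ a b-1) r≃ b≉0 a≈) =
    reduces (ℚᵘ.- f) (ℚᵘ.≃-trans (ℚ.toℚᵘ-homo‿- r) (ℚᵘ.-‿cong r≃)) b≉0
      (trans (fromℤ-neg a) (trans (-‿cong a≈) (-‿distribˡ-* _ _)))

  -- The lowest-terms denominator divides any other one, so it is invertible too.
  ↦⇒fromℚ≈ : ∀ {r x} → r ↦ x → fromℚ r ≈ x
  ↦⇒fromℚ≈ {r@(mkℚ n d-1 coprime)} {x} (reduces (mkℚᵘ a b-1) (*≡* nb≡ad) b≉0 a≈) = begin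
    fromℤ n * D ⁻¹        ≈⟨ *-congʳ (*-cancelʳ b≉0 nB≈xDB) ⟩
    x * D * D ⁻¹          ≈⟨ *-assoc _ _ _ ⟩
    x * (D * D ⁻¹)        ≈⟨ trans (*-congˡ (*-inverseʳ D≉0)) (*-identityʳ x) ⟩
    x                     ∎
    where
    d = suc d-1
    b = suc b-1
    D = d ·ℕ 1#
    B = b ·ℕ 1#
    -- Cross-multiplication gives n b = a d, and n is coprime to d.
    d∣b : d ℕ.∣ b
    d∣b = Coprimality.coprime-divisor (Coprimality.sym (Coprimality.recompute coprime))
      (divides ℤ.∣ a ∣ (≡.trans (≡.sym (ℤ.abs-* n (+ b)))
        (≡.trans (≡.cong ℤ.∣_∣ nb≡ad) (ℤ.abs-* a (+ d)))))
    D≉0 : D ≉ 0#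
    D≉0 D≈0 with d∣b
    ... | divides k b≡kd = b≉0 (trans (·ℕ1-cong b≡kd) (multiple·1≈0 k D≈0))
    nB≈xDB : fromℤ n * B ≈ x * D * B
    nB≈xDB = begin
      fromℤ n * B            ≈⟨ fromℤ-* n (+ b) ⟨
      fromℤ (n ℤ.* + b)      ≡⟨ ≡.cong fromℤ nb≡ad ⟩
      fromℤ (a ℤ.* + d)      ≈⟨ fromℤ-* a (+ d) ⟩
      fromℤ a * D            ≈⟨ *-congʳ a≈ ⟩
      x * B * D              ≈⟨ solve 3 (λ x b d → x :* b :* d := x :* d :* b) refl x B D ⟩
      x * D * B              ∎

  0↦0 : 0ℚ ↦ 0#
  0↦0 = ↦-/ (+ 0) 0 (λ eq → 1≉0 (trans (sym (+-identityʳ 1#)) eq)) (sym (zeroˡ _))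

  1↦1 : 1ℚ ↦ 1#
  1↦1 = ↦-/ (+ 1) 0 (λ eq → 1≉0 (trans (sym (+-identityʳ 1#)) eq)) (sym (*-identityˡ _))

  module _ (t : Carrier) where

    -- f reduces coefficientwise to a polynomial with value x at t.
    data _⇝_ : List ℚ → Carrier → Set (c ⊔ ℓ₁) where
      nil  : ∀ {x} → x ≈ 0# → [] ⇝ x
      cons : ∀ {r f x y z} → r ↦ y → f ⇝ z → x ≈ y + t * z → (r ∷ f) ⇝ x

    ⇝-cong : ∀ {f x y} → x ≈ y → f ⇝ x → f ⇝ y
    ⇝-cong x≈y (nil x≈0)      = nil (trans (sym x≈y) x≈0)
    ⇝-cong x≈y (cons r f x≈)  = cons r f (trans (sym x≈y) x≈)

    ⇝-+ₚ : ∀ {f h x y} → f ⇝ x → h ⇝ y → (f ℚ[x].+ₚ h) ⇝ (x + y)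
    ⇝-+ₚ (nil x≈0) h = ⇝-cong (sym (trans (+-congʳ x≈0) (+-identityˡ _))) h
    ⇝-+ₚ f@(cons _ _ _) (nil y≈0) = ⇝-cong (sym (trans (+-congˡ y≈0) (+-identityʳ _))) f
    ⇝-+ₚ {x = x} {y} (cons {y = a} {z} r f x≈) (cons {y = b} {w} s h y≈) =
      cons (↦-+ r s) (⇝-+ₚ f h) (begin
        x + y                       ≈⟨ +-cong x≈ y≈ ⟩
        a + t * z + (b + t * w)     ≈⟨ solve 5 (λ a b t z w → a :+ t :* z :+ (b :+ t :* w) := a :+ b :+ t :* (z :+ w)) refl a b t z w ⟩
        a + b + t * (z + w)         ∎)

    ⇝-·ₚ : ∀ {s f x y} → s ↦ y → f ⇝ x → (s ℚ[x].·ₚ f) ⇝ (y * x)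
    ⇝-·ₚ s (nil x≈0) = nil (trans (*-congˡ x≈0) (zeroʳ _))
    ⇝-·ₚ {x = x} {y} s (cons {y = a} {z} r f x≈) = cons (↦-* s r) (⇝-·ₚ s f) (begin
      y * x                     ≈⟨ *-congˡ x≈ ⟩
      y * (a + t * z)           ≈⟨ solve 4 (λ y a t z → y :* (a :+ t :* z) := y :* a :+ t :* (y :* z)) refl y a t z ⟩
      y * a + t * (y * z)       ∎)

    ⇝⇒eval≈ : ∀ {f x} → f ⇝ x → eval (map fromℚ f) t ≈ x
    ⇝⇒eval≈ (nil x≈0)      = sym x≈0
    ⇝⇒eval≈ (cons r f x≈)  =
      trans (+-cong (↦⇒fromℚ≈ r) (*-congˡ (⇝⇒eval≈ f))) (sym x≈)

  -- Legendre polynomials modulo p.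

  open Sequence commutativeRing

  -- In characteristic p = 2 m + 1 the power (y² − 2 t y + 1)ᵐ agrees with the Legendre
  -- generating function (y² − 2 t y + 1)^(−1/2) up to degree p − 1, because both
  -- satisfy the same differential equation.
  module _ (m : ℕ) (p≈0 : suc (2 ℕ.* m) ·ℕ 1# ≈ 0#)
           (<p⇒≉0 : ∀ k → k ℕ.< 2 ℕ.* m → suc k ·ℕ 1# ≉ 0#)
           (t α : Carrier) (α+2t≈0 : α + (t + t) ≈ 0#) where

    private
      M = m ·ℕ 1#
      U = trinomial α 1# m

    -- That is, M = -1/2, the exponent of the Legendre generating function.
    1+2M≈0 : 1# + (M + M) ≈ 0#
    1+2M≈0 = trans (+-congˡ (trans (+-congˡ (sym (+-identityʳ M))) (sym (unfold)))) p≈0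
      where
      unfold : (2 ℕ.* m) ·ℕ 1# ≈ M + (M + 0#)
      unfold = trans (×-homo-+ 1# m (m ℕ.+ 0)) (+-congˡ (×-homo-+ 1# m 0))

    Mα≈t : M * α ≈ t
    Mα≈t = begin
      M * α                               ≈⟨ +-identityʳ _ ⟨
      M * α + 0#                          ≈⟨ +-congˡ (trans (*-congʳ 1+2M≈0) (zeroˡ t)) ⟨
      M * α + (1# + (M + M)) * t          ≈⟨ solve 3 (λ M α t → M :* α :+ (con 1 :+ (M :+ M)) :* t := M :* (α :+ (t :+ t)) :+ t) refl M α t ⟩
      M * (α + (t + t)) + t               ≈⟨ +-congʳ (trans (*-congˡ α+2t≈0) (zeroʳ M)) ⟩
      0# + t                              ≈⟨ +-identityˡ t ⟩
      t                                   ∎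

    trinomial-0 : ∀ k → trinomial α 1# k 0 ≈ 1#
    trinomial-0 zero    = refl
    trinomial-0 (suc k) = trans
      (solve 2 (λ α u → con 0 :+ α :* con 0 :+ con 1 :* u := u) refl α (trinomial α 1# k 0))
      (trinomial-0 k)

    trinomial-1 : U 1 ≈ t
    trinomial-1 = begin
      U 1
        ≈⟨ solve 2 (λ α u → u := con 0 :+ α :* con 0 :+ con 1 :* ((con 1 :+ con 0) :* u)) refl α (U 1) ⟩
      quadratic α 1# (derivative α 1# U) 0
        ≈⟨ trinomial-ode α 1# m 0 ⟩
      M * ((1# + 1#) * 0# + α * U 0)
        ≈⟨ solve 3 (λ M α u → M :* ((con 1 :+ con 1) :* con 0 :+ α :* u) := M :* α :* u) refl M α (U 0) ⟩
      M * α * U 0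
        ≈⟨ *-cong Mα≈t (trinomial-0 m) ⟩
      t * 1#
        ≈⟨ *-identityʳ t ⟩
      t ∎

    -- Coefficient of y^(l+1) in the differential equation. On the right, 2M U l = -U l, which moved
    -- to the left turns the factor l of U l into l + 1; then t - α (l + 1) = (2l + 3) t because α =
    -- -2t.
    trinomial-bonnet : ∀ l → let n = l ·ℕ 1# in
      (2 ℕ.+ l) ·ℕ 1# * U (2 ℕ.+ l) + (suc l ·ℕ 1#) * U l ≈
      (2 ℕ.* l ℕ.+ 3) ·ℕ 1# * (t * U (suc l))
    trinomial-bonnet l = +-cancelˡ (α * ((1# + n) * b)) _ _ (begin
      α * ((1# + n) * b) + (X + (1# + n) * a)
        ≈⟨ solve 5 (λ α n a b X → α :* ((con 1 :+ n) :* b) :+ (X :+ (con 1 :+ n) :* a) :=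
             n :* a :+ α :* ((con 1 :+ n) :* b) :+ con 1 :* X :+ a) refl α n a b X ⟩
      n * a + α * ((1# + n) * b) + 1# * X + a
        ≈⟨ +-congʳ (+-congʳ (+-congʳ (boundary l))) ⟨
      quadratic α 1# (derivative α 1# U) (suc l) + a
        ≈⟨ +-congʳ (trinomial-ode α 1# m (suc l)) ⟩
      M * ((1# + 1#) * a + α * b) + a
        ≈⟨ solve 4 (λ M α a b → M :* ((con 1 :+ con 1) :* a :+ α :* b) :+ a :=
             (con 1 :+ (M :+ M)) :* a :+ M :* α :* b) refl M α a b ⟩
      (1# + (M + M)) * a + M * α * b
        ≈⟨ +-cong (trans (*-congʳ 1+2M≈0) (zeroˡ a)) (*-congʳ Mα≈t) ⟩
      0# + t * b
        ≈⟨ +-congʳ (trans (*-congʳ α+2t≈0) (zeroˡ _)) ⟨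
      (α + (t + t)) * ((1# + n) * b) + t * b
        ≈⟨ solve 4 (λ α t n b → (α :+ (t :+ t)) :* ((con 1 :+ n) :* b) :+ t :* b :=
             α :* ((con 1 :+ n) :* b) :+ (n :+ (n :+ con 0) :+ (con 1 :+ (con 1 :+ (con 1 :+ con 0)))) :* (t :* b)) refl α t n b ⟩
      α * ((1# + n) * b) + (n + (n + 0#) + 3 ·ℕ 1#) * (t * b)
        ≈⟨ +-congˡ (*-congʳ (trans (×-homo-+ 1# (2 ℕ.* l) 3)
             (+-congʳ (trans (×-homo-+ 1# l (l ℕ.+ 0)) (+-congˡ (×-homo-+ 1# l 0)))))) ⟨
      α * ((1# + n) * b) + (2 ℕ.* l ℕ.+ 3) ·ℕ 1# * (t * b) ∎)
      where
      n = l ·ℕ 1#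
      a = U l
      b = U (suc l)
      X = (2 ℕ.+ l) ·ℕ 1# * U (2 ℕ.+ l)
      -- The contribution of y² U′. For l = 0 the shift runs off the series and returns 0, in
      -- agreement with the factor l.
      boundary : ∀ l → shift 1 (derivative α 1# U) l ≈ l ·ℕ 1# * U l
      boundary zero    = sym (zeroˡ _)
      boundary (suc l) = refl

    -- Each step of the recurrence divides by its degree, which is at most 2m = p - 1 and therefore
    -- invertible.
    legendre-⇝ : ∀ l → l ℕ.≤ 2 ℕ.* m → _⇝_ t (legendre l) (U l)
    legendre-⇝ zero          _   =
      cons 1↦1 (nil refl) (trans (trinomial-0 m) (sym (trans (+-congˡ (zeroʳ t)) (+-identityʳ 1#))))
    legendre-⇝ (suc zero)    _   =
      cons 0↦0 (cons 1↦1 (nil refl) refl)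
        (trans trinomial-1 (solve 1 (λ t → t := con 0 :+ t :* (con 1 :+ t :* con 0)) refl t))
    -- Multiplying by l + 2 clears the denominators and leaves `trinomial-bonnet`.
    legendre-⇝ (suc (suc l)) l<p = ⇝-cong t (*-cancelʳ N≉0 equation)
      (⇝-+ₚ t
        (⇝-·ₚ t (↦-/ (+ (2 ℕ.* l ℕ.+ 3)) (suc l) N≉0 (sym (scaled A)))
          (cons 0↦0 (legendre-⇝ (suc l) (ℕ.<⇒≤ l<p)) refl))
        (⇝-·ₚ t (↦-neg (↦-/ (+ suc l) (suc l) N≉0 (sym (scaled B))))
          (legendre-⇝ l (ℕ.<⇒≤ (ℕ.<⇒≤ l<p)))))
      where
      N = (2 ℕ.+ l) ·ℕ 1#
      A = (2 ℕ.* l ℕ.+ 3) ·ℕ 1#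
      B = suc l ·ℕ 1#
      a = U l
      b = U (suc l)
      X = N * U (2 ℕ.+ l)
      N≉0 : N ≉ 0#
      N≉0 = <p⇒≉0 (suc l) l<p
      scaled : ∀ x → x * N ⁻¹ * N ≈ x
      scaled x = trans (*-assoc _ _ _) (trans (*-congˡ (trans (*-comm _ _) (*-inverseʳ N≉0))) (*-identityʳ x))
      equation : (A * N ⁻¹ * (0# + t * b) + - (B * N ⁻¹) * a) * N ≈ U (2 ℕ.+ l) * N
      equation = begin
        (A * N ⁻¹ * (0# + t * b) + - (B * N ⁻¹) * a) * N
          ≈⟨ *-congʳ (+-congˡ (-‿distribˡ-* _ _)) ⟨
        (A * N ⁻¹ * (0# + t * b) + - (B * N ⁻¹ * a)) * N
          ≈⟨ trans (distribʳ _ _ _) (+-congˡ (sym (-‿distribˡ-* _ _))) ⟩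
        A * N ⁻¹ * (0# + t * b) * N - B * N ⁻¹ * a * N
          ≈⟨ +-cong (solve 5 (λ A i t b N → A :* i :* (con 0 :+ t :* b) :* N := A :* i :* N :* (t :* b)) refl A (N ⁻¹) t b N)
                    (-‿cong (solve 4 (λ B i a N → B :* i :* a :* N := B :* i :* N :* a) refl B (N ⁻¹) a N)) ⟩
        A * N ⁻¹ * N * (t * b) - B * N ⁻¹ * N * a
          ≈⟨ +-cong (*-congʳ (scaled A)) (-‿cong (*-congʳ (scaled B))) ⟩
        A * (t * b) - B * a
          ≈⟨ +-congʳ (trinomial-bonnet l) ⟨
        X + B * a - B * a
          ≈⟨ trans (+-assoc _ _ _) (trans (+-congˡ (-‿inverseʳ _)) (+-identityʳ X)) ⟩
        X
          ≈⟨ *-comm _ _ ⟩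
        U (2 ℕ.+ l) * N ∎

    evalLegendre≈trinomial : ∀ l → l ℕ.≤ 2 ℕ.* m → evalLegendre l t ≈ U l
    evalLegendre≈trinomial l l<p = ⇝⇒eval≈ t (legendre-⇝ l l<p)

-- Arithmetic of the exponent ip - j.

half-odd-prime : ∀ {p} → Prime p → 2 ℕ.< p → p ≡ suc (2 ℕ.* half p)
half-odd-prime {suc p-1} p-prime 2<p
  with p-1 ℕ.% 2 | ℕ.m≡m%n+[m/n]*n p-1 2 | ℕ.m%n<n p-1 2
... | 0 | eq | _ = ≡.cong suc (≡.trans eq (ℕ.*-comm (p-1 ℕ./ 2) 2))
-- Here p is even, so irreducibility leaves only p = 2.
... | 1 | eq | _ with prime⇒irreducible p-prime (divides (suc (p-1 ℕ./ 2)) (≡.cong suc eq))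
...   | inj₂ 2≡p = contradiction 2≡p (ℕ.<⇒≢ 2<p)
half-odd-prime _ _ | suc (suc _) | _ | s≤s (s≤s ())

-- Integer division rounds down; with remainder zero there is no correction for negative numerators.
neg-/ℕ : ∀ n d .{{_ : NonZero d}} → n ℕ.% d ≡ 0 → (ℤ.- + n) /ℕ d ≡ ℤ.- + (n ℕ./ d)
neg-/ℕ zero    d _  = ≡.trans (≡.cong +_ (ℕ.0/n≡0 d)) (≡.cong (λ k → ℤ.- + k) (≡.sym (ℕ.0/n≡0 d)))
neg-/ℕ (suc n) d eq with suc n ℕ.% d | eq
... | zero | _ = ≡.refl

module CartierManinIndex (p m g : ℕ) .{{_ : NonZero g}} (p≡1+2m : p ≡ suc (2 ℕ.* m))
  (i j : Fin g) where

  open ≡ using (cong; sym; trans)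

  private
    A = suc (toℕ i) ℕ.* p
    B = suc (toℕ j)
    k = cmIndex p i j

  k-m≡⊖ : k ℤ.- + m ≡ A ℤ.⊖ (B ℕ.+ m)
  k-m≡⊖ = begin
    + A ℤ.- + B ℤ.- + m                ≡⟨ ℤ.+-assoc (+ A) (ℤ.- + B) (ℤ.- + m) ⟩
    + A ℤ.+ (ℤ.- + B ℤ.- + m)          ≡⟨ cong (ℤ._+_ (+ A)) (ℤ.neg-distrib-+ (+ B) (+ m)) ⟨
    + A ℤ.- + (B ℕ.+ m)                ≡⟨ ℤ.m-n≡m⊖n A (B ℕ.+ m) ⟩
    A ℤ.⊖ (B ℕ.+ m)                    ∎
    where open ≡.≡-Reasoning

  k≡⇒g∣k-m : ∀ l → k ≡ + (m ℕ.+ l ℕ.* g) → + g ∣ k ℤ.- + m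
  k≡⇒g∣k-m l k≡ = divides l (cong ℤ.∣_∣ (begin
    k ℤ.- + m                      ≡⟨ cong (ℤ._- + m) k≡ ⟩
    + (m ℕ.+ l ℕ.* g) ℤ.- + m      ≡⟨ ℤ.m-n≡m⊖n (m ℕ.+ l ℕ.* g) m ⟩
    (m ℕ.+ l ℕ.* g) ℤ.⊖ m          ≡⟨ ℤ.⊖-≥ (ℕ.m≤m+n m _) ⟩
    + (m ℕ.+ l ℕ.* g ℕ.∸ m)        ≡⟨ cong +_ (ℕ.m+n∸m≡n m _) ⟩
    + (l ℕ.* g)                    ∎))
    where open ≡.≡-Reasoning

  module _ (g∣k-m : + g ∣ k ℤ.- + m) where

    -- Because i p ≥ p > m and j ≤ g.
    B+m<A+g : B ℕ.+ m ℕ.< A ℕ.+ g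
    B+m<A+g = begin-strict
      B ℕ.+ m              ≡⟨ ℕ.+-comm B m ⟩
      m ℕ.+ B              <⟨ ℕ.+-mono-<-≤ m<A (toℕ<n j) ⟩
      A ℕ.+ g              ∎
      where
      open ℕ.≤-Reasoning
      m<A : m ℕ.< A
      m<A = ℕ.<-≤-trans (≡.subst (m ℕ.<_) (sym p≡1+2m) (s≤s (ℕ.m≤m+n m _))) (ℕ.m≤m+n p _)

    -- As k − m > −g, divisibility by g forces k ≥ m.
    B+m≤A : B ℕ.+ m ℕ.≤ A
    B+m≤A with B ℕ.+ m ℕ.≤? A
    ... | yes ≤ = ≤
    ... | no  ≰ = contradiction (ℕ.∣⇒≤ {{ℕ.>-nonZero (ℕ.m<n⇒0<n∸m A<B+m)}} g∣) (ℕ.<⇒≱ small)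
      where
      A<B+m = ℕ.≰⇒> ≰
      g∣ : g ℕ.∣ B ℕ.+ m ℕ.∸ A
      g∣ = ≡.subst (g ℕ.∣_) (trans (cong ℤ.∣_∣ k-m≡⊖) (ℤ.∣⊖∣-≤ (ℕ.<⇒≤ A<B+m))) g∣k-m
      small : B ℕ.+ m ℕ.∸ A ℕ.< g
      small = ℕ.m<n+o⇒m∸n<o (B ℕ.+ m) A B+m<A+g

    private
      g∣A∸[B+m] : g ℕ.∣ A ℕ.∸ (B ℕ.+ m)
      g∣A∸[B+m] = ≡.subst (g ℕ.∣_) (cong ℤ.∣_∣ (trans k-m≡⊖ (ℤ.⊖-≥ B+m≤A))) g∣k-m

    l : ℕ
    l = ℕ.quotient g∣A∸[B+m]

    l*g≡ : A ℕ.∸ (B ℕ.+ m) ≡ l ℕ.* g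
    l*g≡ = ℕ._∣_.equality g∣A∸[B+m]

    k-m≡l*g : k ℤ.- + m ≡ + (l ℕ.* g)
    k-m≡l*g = trans k-m≡⊖ (trans (ℤ.⊖-≥ B+m≤A) (cong +_ l*g≡))

    k≡m+l*g : k ≡ + (m ℕ.+ l ℕ.* g)
    k≡m+l*g = begin
      k                          ≡⟨ ℤ.+-identityʳ k ⟨
      k ℤ.+ + 0                  ≡⟨ cong (λ x → k ℤ.+ x) (ℤ.+-inverseˡ (+ m)) ⟨
      k ℤ.+ (ℤ.- + m ℤ.+ + m)    ≡⟨ ℤ.+-assoc k (ℤ.- + m) (+ m) ⟨
      k ℤ.- + m ℤ.+ + m          ≡⟨ cong (ℤ._+ + m) k-m≡l*g ⟩
      + (l ℕ.* g ℕ.+ m)          ≡⟨ cong +_ (ℕ.+-comm _ m) ⟩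
      + (m ℕ.+ l ℕ.* g)          ∎
      where open ≡.≡-Reasoning

    -- From l g = ip - j - m < g p, so l < p.
    l≤2m : l ℕ.≤ 2 ℕ.* m
    l≤2m = ℕ.≤-pred (≡.subst (l ℕ.<_) p≡1+2m (ℕ.*-cancelʳ-< g l p (begin-strict
      l ℕ.* g                    ≡⟨ l*g≡ ⟨
      A ℕ.∸ (B ℕ.+ m)            <⟨ ℕ.∸-monoʳ-< {A} {B ℕ.+ m} {0} (s≤s z≤n) B+m≤A ⟩
      A                          ≤⟨ ℕ.*-monoˡ-≤ p (toℕ<n i) ⟩
      g ℕ.* p                    ≡⟨ ℕ.*-comm g p ⟩
      p ℕ.* g                    ∎)))
      where open ℕ.≤-Reasoning

    l≡[k-m]/g : + l ≡ (k ℤ.- + m) /ℕ g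
    l≡[k-m]/g = sym (trans (cong (_/ℕ g) k-m≡l*g) (cong +_ (ℕ.m*n/n≡m l g)))

    -- The exponent of √b is a natural number, so `_^ℤ_` is an ordinary power here and involves no
    -- inverse.
    exponent≡ : + (2 ℕ.* m) ℤ.+ (+ m ℤ.- k) /ℕ g ≡ + (2 ℕ.* m ℕ.∸ l)
    exponent≡ = begin
      + (2 ℕ.* m) ℤ.+ (+ m ℤ.- k) /ℕ g          ≡⟨ cong (λ x → + (2 ℕ.* m) ℤ.+ x /ℕ g) m-k≡ ⟩
      + (2 ℕ.* m) ℤ.+ (ℤ.- + (l ℕ.* g)) /ℕ g    ≡⟨ cong (ℤ._+_ (+ (2 ℕ.* m))) (neg-/ℕ (l ℕ.* g) g (ℕ.m*n%n≡0 l g)) ⟩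
      + (2 ℕ.* m) ℤ.- + (l ℕ.* g ℕ./ g)         ≡⟨ cong (λ x → + (2 ℕ.* m) ℤ.- + x) (ℕ.m*n/n≡m l g) ⟩
      + (2 ℕ.* m) ℤ.- + l                       ≡⟨ ℤ.m-n≡m⊖n (2 ℕ.* m) l ⟩
      (2 ℕ.* m) ℤ.⊖ l                           ≡⟨ ℤ.⊖-≥ l≤2m ⟩
      + (2 ℕ.* m ℕ.∸ l)                         ∎
      where
      open ≡.≡-Reasoning
      m-k≡ : + m ℤ.- k ≡ ℤ.- + (l ℕ.* g)
      m-k≡ = begin
        + m ℤ.- k                  ≡⟨ cong (ℤ._- k) (ℤ.neg-involutive (+ m)) ⟨
        ℤ.- (ℤ.- + m) ℤ.- k        ≡⟨ ℤ.neg-distrib-+ (ℤ.- + m) k ⟨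
        ℤ.- (ℤ.- + m ℤ.+ k)        ≡⟨ cong ℤ.-_ (ℤ.+-comm (ℤ.- + m) k) ⟩
        ℤ.- (k ℤ.- + m)            ≡⟨ cong ℤ.-_ k-m≡l*g ⟩
        ℤ.- + (l ℕ.* g)            ∎

-- Matrix entries as coefficients of the quadratic's powers, and base change.

module CartierManin (R : CommutativeRing c ℓ) (g : ℕ) .{{_ : NonZero g}} where
  open CommutativeRing R
  open Polynomial R
  open Sequence R
  open CurvePower R

  cartierManin-on : ∀ p a b (i j : Fin g) l → cmIndex p i j ≡ + (half p ℕ.+ l ℕ.* g) →
    cartierManin R p g (curve g a b) i j ≈ trinomial a b (half p) l
  cartierManin-on p a b i j l k≡ = trans
    (reflexive (≡.cong (coeffℤ (curve g a b ^ₚ half p)) k≡))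
    (proj₁ (curve-^ₚ-Spread g a b (half p)) l)

  cartierManin-off : ∀ p a b (i j : Fin g) →
    (∀ l → cmIndex p i j ≢ + (half p ℕ.+ l ℕ.* g)) →
    cartierManin R p g (curve g a b) i j ≈ 0#
  cartierManin-off p a b i j k≢ with cmIndex p i j
  ... | + k      = proj₂ (curve-^ₚ-Spread g a b (half p)) k (λ l k≡ → k≢ l (≡.cong +_ k≡))
  -- A negative exponent has coefficient 0 by convention.
  ... | -[1+ _ ] = refl

module Homomorphism (R : CommutativeRing c ℓ) (S : CommutativeRing c′ ℓ′)
  (ι : CommutativeRing.Carrier R → CommutativeRing.Carrier S)
  (ι-hom : RingMorphisms.IsRingHomomorphism (CommutativeRing.rawRing R) (CommutativeRing.rawRing S) ι)
  where
  private
    module R = CommutativeRing R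
    module SR = Sequence R
    module SS = Sequence S
  open CommutativeRing S
  open RingMorphisms.IsRingHomomorphism ι-hom
  open import Relation.Binary.Reasoning.Setoid setoid

  shift-homo : ∀ k {u v} → (∀ n → ι (u n) ≈ v n) → ∀ n → ι (SR.shift k u n) ≈ SS.shift k v n
  shift-homo zero    u≈v n       = u≈v n
  shift-homo (suc k) u≈v zero    = 0#-homo
  shift-homo (suc k) u≈v (suc n) = shift-homo k u≈v n

  -- Carries an entry computed over the base field to the extension, where √b is available.
  trinomial-homo : ∀ a b m l → ι (SR.trinomial a b m l) ≈ SS.trinomial (ι a) (ι b) m l
  trinomial-homo a b zero    zero    = 1#-homo
  trinomial-homo a b zero    (suc l) = 0#-homo
  trinomial-homo a b (suc m) l       = begin
    ι (SR.shift 2 u l R.+ a R.* SR.shift 1 u l R.+ b R.* u l)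
      ≈⟨ trans (+-homo _ _) (+-cong (+-homo _ _) (*-homo _ _)) ⟩
    ι (SR.shift 2 u l) + ι (a R.* SR.shift 1 u l) + ι b * ι (u l)
      ≈⟨ +-cong (+-cong (shift-homo 2 (trinomial-homo a b m) l)
           (trans (*-homo _ _) (*-congˡ (shift-homo 1 (trinomial-homo a b m) l))))
           (*-congˡ (trinomial-homo a b m l)) ⟩
    SS.trinomial (ι a) (ι b) (suc m) l ∎
    where u = SR.trinomial a b m

theorem4 :
    ∀ {c ℓ₁ ℓ₂ c′ ℓ₁′ ℓ₂′} (p n g : ℕ) .{{_ : NonZero g}} →
    Prime p → 2 ℕ.< p → gcd p g ≡ 1 →
    (F : FiniteField (p ℕ.^ n) c ℓ₁ ℓ₂) →
    (K : FiniteField ((p ℕ.^ n) ℕ.^ 2) c′ ℓ₁′ ℓ₂′) →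
    let module F = FiniteField F
        module K = FiniteField K in
    (ι : F.Carrier → K.Carrier) →
    RingMorphisms.IsRingHomomorphism F.rawRing K.rawRing ι →
    (a b : F.Carrier) → ¬ (b F.≈ F.0#) →
    F.IsHyperelliptic g (F.curve g a b) →
    (√b : K.Carrier) → √b K.* √b K.≈ ι b →
    (i j : Fin g) →
    let m = half p
        k = cmIndex p i j
        e = + (2 ℕ.* m) ℤ.+ (+ m ℤ.- k) /ℕ g
        w = cartierManin F.commutativeRing p g (F.curve g a b) i j
        w₁ = cartierManin K.commutativeRing p g (K.curve g (ι a K.* √b K.⁻¹) K.1#) i j
        t = K.- (ι a K.* (2 K.× K.1# K.* √b) K.⁻¹)
    in
    (+ g ∣ k ℤ.- + m →
      Σ[ l ∈ ℕ ] (+ l ≡ (k ℤ.- + m) /ℕ g)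
        × (ι w K.≈ √b K.^ℤ e K.* w₁)
        × (√b K.^ℤ e K.* w₁ K.≈ √b K.^ℤ e K.* K.evalLegendre l t)
        × (Σ[ v ∈ F.Carrier ] ι v K.≈ √b K.^ℤ e K.* K.evalLegendre l t))
    × (¬ (+ g ∣ k ℤ.- + m) → w F.≈ F.0#)
theorem4 p n g p-prime 2<p _ F K ι ι-hom a b b≉0 _ √b √b²≈b i j = divisible , indivisible
  where
  module F = FiniteField F
  module K = FiniteField K
  open CommutativeRing K.commutativeRing
  open SemiringMult semiring using () renaming (_×_ to _·ℕ_)
  open Sequence K.commutativeRing
  open FieldProperties K
  open RingMorphisms.IsRingHomomorphism ι-hom
  open import Algebra.Properties.CommutativeSemiring.Exp commutativeSemiring
    using (_^_; ^-homo-*; ^-distrib-*)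
  open import Algebra.Properties.Ring ring using (-‿+-comm)
  open import Algebra.Solver.Ring.NaturalCoefficients.Default commutativeSemiring
  open import Relation.Binary.Reasoning.Setoid setoid

  m = half p
  k = cmIndex p i j
  w = cartierManin F.commutativeRing p g (F.curve g a b) i j
  α = ι a * √b K.⁻¹
  t = - (ι a * (2 K.× 1# * √b) K.⁻¹)
  w₁ = cartierManin K.commutativeRing p g (K.curve g α 1#) i j
  e = + (2 ℕ.* m) ℤ.+ (+ m ℤ.- k) /ℕ g

  p≡1+2m : p ≡ suc (2 ℕ.* m)
  p≡1+2m = half-odd-prime p-prime 2<p

  -- The extension has (pⁿ)² elements, so two descents through powers reach p.
  p≈0 : p ·ℕ 1# ≈ 0#
  p≈0 = ^·1≈0⇒·1≈0 p n (^·1≈0⇒·1≈0 (p ℕ.^ n) 2 order·1≈0)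

  -- The inverse of b maps to an inverse of ι b = √b √b, so neither factor can vanish.
  √b≉0 : √b ≉ 0#
  √b≉0 = x*y≉0⇒x≉0 (λ √b²≈0 → x*y≉0⇒x≉0 {y = ι (b F.⁻¹)}
    (λ bb⁻¹≈0 → 1≉0 (begin
      1#                    ≈⟨ 1#-homo ⟨
      ι F.1#                ≈⟨ ⟦⟧-cong (FieldProperties.*-inverseʳ F b≉0) ⟨
      ι (b F.* b F.⁻¹)      ≈⟨ *-homo _ _ ⟩
      ι b * ι (b F.⁻¹)      ≈⟨ bb⁻¹≈0 ⟩
      0#                    ∎))
    (trans (sym √b²≈b) √b²≈0))

  √bα≈a : ι a ≈ √b * α
  √bα≈a = sym (begin
    √b * (ι a * √b K.⁻¹)   ≈⟨ solve 3 (λ s a i → s :* (a :* i) := a :* (s :* i)) refl √b (ι a) (√b K.⁻¹) ⟩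
    ι a * (√b * √b K.⁻¹)   ≈⟨ trans (*-congˡ (*-inverseʳ √b≉0)) (*-identityʳ _) ⟩
    ι a                    ∎)

  α+2t≈0 : α + (t + t) ≈ 0#
  α+2t≈0 = trans (+-cong α≈ (-‿+-comm x x)) (-‿inverseʳ _)
    where
    d = 2 K.× 1# * √b
    x = ι a * d K.⁻¹
    -- a / √b is twice a / (2 √b); the denominator is invertible because 2 < p.
    α≈ : α ≈ x + x
    α≈ = *-cancelʳ √b≉0 (begin
      α * √b                       ≈⟨ trans (*-comm _ _) (sym √bα≈a) ⟩
      ι a                          ≈⟨ trans (*-congˡ (*-inverseʳ (x*y≉0 (<p⇒·1≉0 p-prime p≈0 1 2<p) √b≉0))) (*-identityʳ _) ⟨
      ι a * (d * d K.⁻¹)           ≈⟨ solve 3 (λ a s i →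
                                        a :* ((con 1 :+ (con 1 :+ con 0)) :* s :* i) :=
                                        (a :* i :+ a :* i) :* s) refl (ι a) √b (d K.⁻¹) ⟩
      (x + x) * √b                 ∎)

  open CartierManinIndex p m g p≡1+2m i j

  indivisible : ¬ (+ g ∣ k ℤ.- + m) → w F.≈ F.0#
  indivisible g∤ = CartierManin.cartierManin-off F.commutativeRing g p a b i j
    (λ l k≡ → g∤ (k≡⇒g∣k-m l k≡))

  divisible : + g ∣ k ℤ.- + m → Σ[ l ∈ ℕ ] (+ l ≡ (k ℤ.- + m) /ℕ g)
        × (ι w ≈ √b K.^ℤ e * w₁)
        × (√b K.^ℤ e * w₁ ≈ √b K.^ℤ e * K.evalLegendre l t)
        × (Σ[ v ∈ F.Carrier ] ι v ≈ √b K.^ℤ e * K.evalLegendre l t)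
  -- The value lies in the base field because it is the image of `w` itself.
  divisible g∣ = d , l≡[k-m]/g g∣ , scaling , legendre-value , w , trans scaling legendre-value
    where
    d = l g∣
    w₁≈ : w₁ ≈ trinomial α 1# m d
    w₁≈ = CartierManin.cartierManin-on K.commutativeRing g p α 1# i j d (k≡m+l*g g∣)

    legendre-value : √b K.^ℤ e * w₁ ≈ √b K.^ℤ e * K.evalLegendre d t
    legendre-value = *-congˡ (trans w₁≈ (sym (evalLegendre≈trinomial m
      (trans (·ℕ1-cong (≡.sym p≡1+2m)) p≈0)
      (λ x x<2m → <p⇒·1≉0 p-prime p≈0 x (≡.subst (suc x ℕ.<_) (≡.sym p≡1+2m) (s≤s x<2m)))
      t α α+2t≈0 d (l≤2m g∣))))

    ιw≈ : ι w ≈ trinomial (ι a) (ι b) m d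
    ιw≈ = trans
      (⟦⟧-cong (CartierManin.cartierManin-on F.commutativeRing g p a b i j d (k≡m+l*g g∣)))
      (Homomorphism.trinomial-homo F.commutativeRing K.commutativeRing ι ι-hom a b m d)

    scaling : ι w ≈ √b K.^ℤ e * w₁
    -- Homogeneity is an identity with an extra factor √b^l on the left, which is cancelled against
    -- √b^(2m) = √b^(2m - l) √b^l.
    scaling = *-cancelʳ (^-≉0 d √b≉0) (begin
      ι w * √b ^ d
        ≈⟨ *-congʳ ιw≈ ⟩
      trinomial (ι a) (ι b) m d * √b ^ d
        ≈⟨ trinomial-homogeneous √bα≈a (trans (sym √b²≈b) (sym (*-identityʳ _))) m d ⟩
      (√b * √b) ^ m * trinomial α 1# m d
        ≈⟨ *-cong √b²ᵐ (sym w₁≈) ⟩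
      √b ^ (2 ℕ.* m ℕ.∸ d) * √b ^ d * w₁
        ≈⟨ solve 3 (λ x y z → x :* y :* z := x :* z :* y) refl _ _ _ ⟩
      √b ^ (2 ℕ.* m ℕ.∸ d) * w₁ * √b ^ d
        ≡⟨ ≡.cong (λ x → √b K.^ℤ x * w₁ * √b ^ d) (exponent≡ g∣) ⟨
      √b K.^ℤ e * w₁ * √b ^ d ∎)
      where
      √b²ᵐ : (√b * √b) ^ m ≈ √b ^ (2 ℕ.* m ℕ.∸ d) * √b ^ d
      √b²ᵐ = begin
        (√b * √b) ^ m                          ≈⟨ ^-distrib-* √b √b m ⟩
        √b ^ m * √b ^ m                        ≈⟨ ^-homo-* √b m m ⟨
        √b ^ (m ℕ.+ m)                         ≡⟨ ≡.cong (√b ^_) (≡.trans (≡.cong (m ℕ.+_) (≡.sym (ℕ.+-identityʳ m))) (≡.sym (ℕ.m∸n+n≡m (l≤2m g∣)))) ⟩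
        √b ^ (2 ℕ.* m ℕ.∸ d ℕ.+ d)           ≈⟨ ^-homo-* √b (2 ℕ.* m ℕ.∸ d) d ⟩
        √b ^ (2 ℕ.* m ℕ.∸ d) * √b ^ d        ∎
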